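{- Let $q$ be a prime power, $n\ge1$, and let $\Delta_n$ be the subgroup of diagonal matrices in $\operatorname{GL}_n(\mathbb F_q)$. Then $$|\Delta_n\backslash\operatorname{GL}_n(\mathbb F_q)/\Delta_n|=\frac{n!^2}{(q-1)^{2n}}\sum_{\lambda\vdash n}\prod_{i=1}^{\ell(\lambda)}(q-i)\prod_{k\ge1}\frac{\prod_{j=0}^{k-1}(q^k-q^j)^{m_k}}{k!^{2m_k}\,m_k!},$$ where for each partition $\lambda=[1^{m_1},2^{m_2},\dots]$ of $n$, $m_k$ is the number of parts of $\lambda$ equal to $k$ and $\ell(\lambda)$ is its number of parts. -}

module Defs where

open import Level using (Level; _⊔_) renaming (suc to lsuc)
open import Data.Nat as ℕ using (ℕ; zero; suc)
open import Data.Nat.Primality using (Prime)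
open import Data.Nat.Base using (_!)
open import Data.Integer using (+_)
open import Data.Rational as ℚ using (ℚ; 0ℚ; 1ℚ; _÷_; ≢-nonZero)
open import Data.Rational.Properties using () renaming (_≟_ to _≟ℚ_)
open import Data.Fin as Fin using (Fin; toℕ)
open import Data.Vec as Vec using (Vec; []; _∷_; lookup; tabulate)
open import Data.List as List using (List; [_]; upTo; concatMap; filter; length)
open import Data.List.Relation.Unary.All using (All)
open import Data.List.Relation.Unary.Any using (Any)
open import Data.List.Relation.Unary.AllPairs using (AllPairs)
open import Data.Product using (Σ; ∃; ∃₂; _×_; _,_)
open import Relation.Nullary using (¬_; yes; no)
open import Relation.Binary.PropositionalEquality using (_≡_; _≢_)
open import Algebra.Bundles using (CommutativeRing)

IsPrimePower : ℕ → Set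
IsPrimePower q = Σ ℕ λ p → Σ ℕ λ k → Prime p × 1 ℕ.≤ k × q ≡ p ℕ.^ k

record FiniteField (c ℓ : Level) (q : ℕ) : Set (lsuc (c ⊔ ℓ)) where
  field
    commRing : CommutativeRing c ℓ
  open CommutativeRing commRing public
  field
    0≉1             : ¬ (0# ≈ 1#)
    inverse         : ∀ x → ¬ (x ≈ 0#) → ∃ λ y → x * y ≈ 1#
    enum            : Fin q → Carrier
    enum-injective  : ∀ i j → enum i ≈ enum j → i ≡ j
    enum-surjective : ∀ x → ∃ λ i → enum i ≈ x

module Matrices {c ℓ q} (F : FiniteField c ℓ q) where
  open FiniteField F

  Mat : ℕ → Set c
  Mat n = Fin n → Fin n → Carrier

  ∑ : ∀ {n} → (Fin n → Carrier) → Carrier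
  ∑ {zero}  f = 0#
  ∑ {suc n} f = f Fin.zero + ∑ (λ i → f (Fin.suc i))

  _·_ : ∀ {n} → Mat n → Mat n → Mat n
  (A · B) i j = ∑ (λ k → A i k * B k j)

  I : ∀ {n} → Mat n
  I i j with i Fin.≟ j
  ... | yes _ = 1#
  ... | no  _ = 0#

  _≋_ : ∀ {n} → Mat n → Mat n → Set ℓ
  A ≋ B = ∀ i j → A i j ≈ B i j

  GL : ∀ n → Mat n → Set (c ⊔ ℓ)
  GL n A = ∃ λ (B : Mat n) → (A · B) ≋ I × (B · A) ≋ I

  Δ : ∀ n → Mat n → Set (c ⊔ ℓ)
  Δ n D = (∀ i j → i ≢ j → D i j ≈ 0#) × GL n D

  SameDoubleCoset : ∀ n → Mat n → Mat n → Set (c ⊔ ℓ)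
  SameDoubleCoset n A B =
    ∃₂ λ (D₁ D₂ : Mat n) → Δ n D₁ × Δ n D₂ × B ≋ ((D₁ · A) · D₂)

  NumDoubleCosets : ∀ n → ℕ → Set (c ⊔ ℓ)
  NumDoubleCosets n k =
    Σ (List (Mat n)) λ reps →
        length reps ≡ k
      × All (GL n) reps
      × AllPairs (λ A B → ¬ SameDoubleCoset n A B) reps
      × (∀ A → GL n A → Any (λ R → SameDoubleCoset n R A) reps)

ι : ℕ → ℚ
ι n = + n ℚ./ 1

-- division (only ever used with a nonzero divisor; returns 0 on 0)
_÷'_ : ℚ → ℚ → ℚ
p ÷' r with r ≟ℚ 0ℚ
... | yes _ = 0ℚ
... | no r≢0 = _÷_ p r {{≢-nonZero r≢0}}

prodFrom : ℕ → ℕ → (ℕ → ℚ) → ℚ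
prodFrom a zero    f = 1ℚ
prodFrom a (suc n) f = f a ℚ.* prodFrom (suc a) n f

sumList : List ℚ → ℚ
sumList = List.foldr ℚ._+_ 0ℚ

-- Partitions of n, encoded by multiplicity vectors
-- m = (m_1, …, m_n) (stored at positions 0 … n-1), m_k = number of parts
-- equal to k, subject to ∑ k m_k = n.  (Parts of a partition of n are
-- ≤ n, and each m_k ≤ n.)

vecs : (b n : ℕ) → List (Vec ℕ n)
vecs b zero    = [ [] ]
vecs b (suc n) = concatMap (λ x → List.map (x ∷_) (vecs b n)) (upTo (suc b))

weight : ∀ {n} → Vec ℕ n → ℕ
weight {n} m = Vec.sum (tabulate {n = n} λ i → suc (toℕ i) ℕ.* lookup m i)

partitions : (n : ℕ) → List (Vec ℕ n)
partitions n = filter (λ m → weight m ℕ.≟ n) (vecs n n)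

numParts : ∀ {n} → Vec ℕ n → ℕ
numParts = Vec.sum

mult : ∀ {n} → Vec ℕ n → ℕ → ℕ
mult []       k             = 0
mult (x ∷ xs) zero          = 0
mult (x ∷ xs) (suc zero)    = x
mult (x ∷ xs) (suc (suc k)) = mult xs (suc k)

-- ∏_{i=1}^{ℓ(λ)} (q - i) · ∏_{k=1}^{n} ∏_{j=0}^{k-1} (q^k - q^j)^{m_k} / (k!^{2 m_k} m_k!)
-- (factors with k > n have m_k = 0 and equal 1)
term : (q : ℕ) → ∀ {n} → Vec ℕ n → ℚ
term q {n} m =
  prodFrom 1 (numParts m) (λ i → ι q ℚ.- ι i)
  ℚ.* prodFrom 1 n (λ k →
        prodFrom 0 k (λ j → prodFrom 0 (mult m k) (λ _ → ι (q ℕ.^ k) ℚ.- ι (q ℕ.^ j)))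
        ÷' ι ((k !) ℕ.^ (2 ℕ.* mult m k) ℕ.* (mult m k !)))

rhs : ℕ → ℕ → ℚ
rhs q n = (ι ((n !) ℕ.^ 2) ÷' ι ((q ℕ.∸ 1) ℕ.^ (2 ℕ.* n)))
          ℚ.* sumList (List.map (term q) (partitions n))

{-
By Burnside's lemma for Δ × Δ acting on GL_n, the number of double cosets times (q - 1)^2n is the number
of triples (d, e, A) with d A e = A.  After replacing e by its inverse, (d, e) fixes A exactly when the entry
A i j vanishes unless d i = e j, so d and e are regarded as colourings of the rows and columns by the q - 1
units, and A as a matrix respecting the colours.

Invertible coloured matrices are counted row by row: a new row of colour c is any vector supported on the
columns of colour c and outside the span of the earlier rows of colour c, which leaves q^(columns of
colour c) - q^(earlier rows of colour c) choices.  The resulting product depends only on the numbers of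
rows and columns of each colour and vanishes unless these numbers agree.

Summing over all colourings, and splitting off one colour at a time, total(s, n) / n!^2 with s colours is the
coefficient of x^n in (∑ₖ gₖ xᵏ)^s, where gₖ = |GL_k| / k!^2.  The sum over partitions satisfies the same
recursion in s: by s+1 falling l = (s falling l) + l (s falling l-1), one either keeps the partition or
marks one of its parts and removes it.
-}
module Submission where

open import Defs
open import Level using (Level)
open import Data.Nat as ℕ using (ℕ; zero; suc; _≤_; s≤s)
open import Data.Nat.Base using (_!)
import Data.Nat.Properties as ℕP
import Data.Integer as ℤ
import Data.Integer.Properties as ℤP
open import Data.Rational as ℚ using (ℚ; 0ℚ; 1ℚ; _+_; _*_; _-_; -_; ≢-nonZero)
import Data.Rational.Properties as ℚP
import Data.Rational.Unnormalised as ℚᵘ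
import Data.Rational.Unnormalised.Properties as ℚᵘP
open import Data.Rational.Solver using (module +-*-Solver)
open import Data.Fin as Fin using (Fin; toℕ)
import Data.Fin.Properties as FinP
open import Data.Vec as Vec using (Vec; []; _∷_; lookup; tabulate)
import Data.Vec.Properties as VecP
open import Data.List as List using (List; []; _∷_; _++_; concatMap; filter; length; upTo; allFin; deduplicate)
import Data.List.Properties as ListP
open import Data.List.Membership.Propositional using (_∈_; lose; find)
open import Data.List.Membership.Propositional.Properties using (∈-filter⁺; ∈-filter⁻)
open import Data.List.Relation.Unary.All as All using (All; []; _∷_)
import Data.List.Relation.Unary.All.Properties as AllP
open import Data.List.Relation.Unary.AllPairs as AllPairs using (AllPairs; []; _∷_)
import Data.List.Relation.Unary.AllPairs.Properties as AllPairsP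
open import Data.List.Relation.Unary.Any as Any using (Any; here; there)
import Data.List.Relation.Unary.Any.Properties as AnyP
import Data.List.Relation.Unary.Unique.DecSetoid.Properties as UniqueP
open import Data.Product using (Σ; ∃; _×_; _,_; proj₁; proj₂)
open import Data.Sum as Sum using (_⊎_; inj₁; inj₂)
open import Data.Unit using (⊤)
open import Algebra.Bundles using (CommutativeRing)
open import Algebra.Bundles.Raw using (RawRing)
open import Algebra.Structures using (IsCommutativeRing)
open import Algebra.Morphism.Structures using (IsRingMonomorphism)
import Algebra.Morphism.RingMonomorphism as RingMonomorphism
import Algebra.Properties.Ring as RingProperties
import Algebra.Properties.Semiring.Sum as SemiringSum
import Algebra.Solver.Ring.NaturalCoefficients.Default as NaturalCoefficients
open import Function using (_∘_; id)
open import Relation.Nullary using (¬_; Dec; yes; no; contradiction; ¬?; _×-dec_; _→-dec_)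
import Relation.Nullary.Decidable as Dec
open import Relation.Binary using (DecidableEquality; tri<; tri≈; tri>)
open import Relation.Binary.Bundles using (DecSetoid)
open import Relation.Binary.PropositionalEquality
import Relation.Binary.Reasoning.Setoid as SetoidReasoning

-- Cardinalities occur only as sums of rational indicators over explicit enumerations, so a
-- bijection becomes a change of the order of summation and differences such as `Q j - Q i` need no
-- side condition. The given field has a setoid equality and its matrices are functions; both are
-- carried over to `Fin q` and to vectors of rows, where equality is propositional, and only the
-- final count is carried back. Invertibility is counted as independence of the rows, and the fact
-- that `n` independent rows of length `n` span is itself a count. The number of colours is
-- `s = q - 1`, which is why the product of the `q - i` starts at `i = 1`: it is a falling factorial
-- of `s`. Splitting off a colour removes `i` rows and `i′` columns, so the numbers of rows and
-- columns have to vary independently although only `i = i′` survives. Distributing rows and columns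
-- separately is the source of the square in `n!^2`. On the other side, the condition that the size
-- is `n` is not stable under removal of a part. The sums over partitions therefore carry an
-- arbitrary test function of the number of parts and the size.

-- Natural numbers inside the rationals.

private
  -- `ι` normalises by a gcd, which is stuck on a variable. Over the unnormalised denominator 1 its
  -- arithmetic is that of the integers.
  int : ℕ → ℚᵘ.ℚᵘ
  int a = ℚᵘ.mkℚᵘ (ℤ.+ a) 0

  toℚᵘ-ι : ∀ a → ℚ.toℚᵘ (ι a) ℚᵘ.≃ int a
  toℚᵘ-ι a = ℚP.toℚᵘ-fromℚᵘ (int a)

ι-+ : ∀ a b → ι (a ℕ.+ b) ≡ ι a + ι b
ι-+ a b = ℚP.toℚᵘ-injective (begin
  ℚ.toℚᵘ (ι (a ℕ.+ b))             ≈⟨ toℚᵘ-ι (a ℕ.+ b) ⟩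
  int (a ℕ.+ b)                    ≈⟨ ℚᵘ.*≡* (cong (ℤ._* ℤ.+ 1) (sym (cong₂ ℤ._+_ (ℤP.*-identityʳ (ℤ.+ a)) (ℤP.*-identityʳ (ℤ.+ b))))) ⟩
  int a ℚᵘ.+ int b                 ≈⟨ ℚᵘP.+-cong (toℚᵘ-ι a) (toℚᵘ-ι b) ⟨
  ℚ.toℚᵘ (ι a) ℚᵘ.+ ℚ.toℚᵘ (ι b)   ≈⟨ ℚP.toℚᵘ-homo-+ (ι a) (ι b) ⟨
  ℚ.toℚᵘ (ι a + ι b)               ∎)
  where open SetoidReasoning ℚᵘP.≃-setoid

ι-* : ∀ a b → ι (a ℕ.* b) ≡ ι a * ι b
ι-* a b = ℚP.toℚᵘ-injective (begin
  ℚ.toℚᵘ (ι (a ℕ.* b))             ≈⟨ toℚᵘ-ι (a ℕ.* b) ⟩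
  int (a ℕ.* b)                    ≈⟨ ℚᵘ.*≡* (cong (ℤ._* ℤ.+ 1) (ℤP.pos-* a b)) ⟩
  int a ℚᵘ.* int b                 ≈⟨ ℚᵘP.*-cong (toℚᵘ-ι a) (toℚᵘ-ι b) ⟨
  ℚ.toℚᵘ (ι a) ℚᵘ.* ℚ.toℚᵘ (ι b)   ≈⟨ ℚP.toℚᵘ-homo-* (ι a) (ι b) ⟨
  ℚ.toℚᵘ (ι a * ι b)               ∎)
  where open SetoidReasoning ℚᵘP.≃-setoid

ι-suc : ∀ n → ι (suc n) ≡ 1ℚ + ι n
ι-suc = ι-+ 1

ι≢0 : ∀ n → n ≢ 0 → ι n ≢ 0ℚ
ι≢0 zero    n≢0 _  = n≢0 refl
ι≢0 (suc n) _   eq with ℚP.fromℚᵘ-injective {ℚᵘ.mkℚᵘ (ℤ.+ suc n) 0} {ℚᵘ.mkℚᵘ (ℤ.+ 0) 0} eq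
... | ℚᵘ.*≡* ()

-- Indicators and finite sums over lists.

module _ where

  private
    variable
      a b p r t : Level
      A : Set a
      B : Set b
      P : Set p
      R : Set r
      T : Set t

  𝟙 : Dec P → ℚ
  𝟙 (yes _) = 1ℚ
  𝟙 (no _)  = 0ℚ

  𝟙-yes : (P? : Dec P) → P → 𝟙 P? ≡ 1ℚ
  𝟙-yes (yes _) _ = refl
  𝟙-yes (no ¬p) p = contradiction p ¬p

  𝟙-no : (P? : Dec P) → ¬ P → 𝟙 P? ≡ 0ℚ
  𝟙-no (yes p) ¬p = contradiction p ¬p
  𝟙-no (no _)  _  = refl

  -- Inside a sum, an indicator thus serves as a hypothesis for rewriting the other factor.
  𝟙-*-cong : (P? : Dec P) {x y : ℚ} → (P → x ≡ y) → 𝟙 P? * x ≡ 𝟙 P? * y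
  𝟙-*-cong (yes p) eq = cong (1ℚ *_) (eq p)
  𝟙-*-cong (no _) {x} {y} _ = trans (ℚP.*-zeroˡ x) (sym (ℚP.*-zeroˡ y))

  𝟙-¬ : (P? : Dec P) (¬P? : Dec (¬ P)) → 𝟙 ¬P? ≡ 1ℚ - 𝟙 P?
  𝟙-¬ (yes p) ¬P? = 𝟙-no ¬P? (λ ¬p → ¬p p)
  𝟙-¬ (no ¬p) ¬P? = 𝟙-yes ¬P? ¬p

  𝟙-⇔ : (P? : Dec P) (R? : Dec R) → (P → R) → (R → P) → 𝟙 P? ≡ 𝟙 R?
  𝟙-⇔ (yes p) R? f g = sym (𝟙-yes R? (f p))
  𝟙-⇔ (no ¬p) R? f g = sym (𝟙-no R? (¬p ∘ g))

  𝟙-× : ∀ (P? : Dec P) (R? : Dec R) (T? : Dec T) → (T → P × R) → (P × R → T) → 𝟙 T? ≡ 𝟙 P? * 𝟙 R?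
  𝟙-× (yes p) (yes r) T? f g = 𝟙-yes T? (g (p , r))
  𝟙-× (yes p) (no ¬r) T? f g = 𝟙-no T? (¬r ∘ proj₂ ∘ f)
  𝟙-× (no ¬p) R?      T? f g = trans (𝟙-no T? (¬p ∘ proj₁ ∘ f)) (sym (ℚP.*-zeroˡ (𝟙 R?)))

  Sum : List A → (A → ℚ) → ℚ
  Sum []       f = 0ℚ
  Sum (x ∷ xs) f = f x + Sum xs f

  Sum-cong-∈ : (xs : List A) {f g : A → ℚ} → (∀ {x} → x ∈ xs → f x ≡ g x) → Sum xs f ≡ Sum xs g
  Sum-cong-∈ []       eq = refl
  Sum-cong-∈ (x ∷ xs) eq = cong₂ _+_ (eq (here refl)) (Sum-cong-∈ xs (eq ∘ there))

  Sum-cong : (xs : List A) {f g : A → ℚ} → (∀ x → f x ≡ g x) → Sum xs f ≡ Sum xs g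
  Sum-cong xs eq = Sum-cong-∈ xs (λ {x} _ → eq x)

  Sum-0 : (xs : List A) → Sum xs (λ _ → 0ℚ) ≡ 0ℚ
  Sum-0 []       = refl
  Sum-0 (x ∷ xs) = trans (ℚP.+-identityˡ _) (Sum-0 xs)

  Sum-zero : (xs : List A) {f : A → ℚ} → (∀ x → f x ≡ 0ℚ) → Sum xs f ≡ 0ℚ
  Sum-zero xs eq = trans (Sum-cong xs eq) (Sum-0 xs)

  Sum-+ : (xs : List A) (f g : A → ℚ) → Sum xs (λ x → f x + g x) ≡ Sum xs f + Sum xs g
  Sum-+ []       f g = refl
  Sum-+ (x ∷ xs) f g = trans (cong ((f x + g x) +_) (Sum-+ xs f g))
    (solve 4 (λ a b c d → (a :+ b) :+ (c :+ d) := (a :+ c) :+ (b :+ d)) refl (f x) (g x) (Sum xs f) (Sum xs g))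
    where open +-*-Solver

  Sum-*ˡ : (xs : List A) (c : ℚ) (f : A → ℚ) → Sum xs (λ x → c * f x) ≡ c * Sum xs f
  Sum-*ˡ []       c f = sym (ℚP.*-zeroʳ c)
  Sum-*ˡ (x ∷ xs) c f = trans (cong (c * f x +_) (Sum-*ˡ xs c f)) (sym (ℚP.*-distribˡ-+ c _ _))

  Sum-*ʳ : (xs : List A) (c : ℚ) (f : A → ℚ) → Sum xs (λ x → f x * c) ≡ Sum xs f * c
  Sum-*ʳ xs c f = trans (Sum-cong xs (λ x → ℚP.*-comm (f x) c)) (trans (Sum-*ˡ xs c f) (ℚP.*-comm c _))

  Sum-neg : (xs : List A) (f : A → ℚ) → Sum xs (λ x → - f x) ≡ - Sum xs f
  Sum-neg []       f = refl
  Sum-neg (x ∷ xs) f = trans (cong (- f x +_) (Sum-neg xs f)) (sym (ℚP.neg-distrib-+ (f x) _))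

  Sum-∸ : (xs : List A) (f g : A → ℚ) → Sum xs (λ x → f x - g x) ≡ Sum xs f - Sum xs g
  Sum-∸ xs f g = trans (Sum-+ xs f (λ x → - g x)) (cong (Sum xs f +_) (Sum-neg xs g))

  Sum-swap : (xs : List A) (ys : List B) (f : A → B → ℚ) →
    Sum xs (λ x → Sum ys (f x)) ≡ Sum ys (λ y → Sum xs (λ x → f x y))
  Sum-swap []       ys f = sym (Sum-0 ys)
  Sum-swap (x ∷ xs) ys f = trans (cong (Sum ys (f x) +_) (Sum-swap xs ys f)) (sym (lem ys))
    where
    lem : ∀ ys → Sum ys (λ y → f x y + Sum xs (λ x → f x y)) ≡ Sum ys (f x) + Sum ys (λ y → Sum xs (λ x → f x y))
    lem []       = refl
    lem (y ∷ ys) = trans (cong ((f x y + Sum xs (λ x → f x y)) +_) (lem ys))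
      (solve 4 (λ a b c d → (a :+ b) :+ (c :+ d) := (a :+ c) :+ (b :+ d)) refl
        (f x y) (Sum xs (λ x → f x y)) (Sum ys (f x)) (Sum ys (λ y → Sum xs (λ x → f x y))))
      where open +-*-Solver

  Sum-++ : (xs ys : List A) (f : A → ℚ) → Sum (xs ++ ys) f ≡ Sum xs f + Sum ys f
  Sum-++ []       ys f = sym (ℚP.+-identityˡ _)
  Sum-++ (x ∷ xs) ys f = trans (cong (f x +_) (Sum-++ xs ys f)) (sym (ℚP.+-assoc (f x) _ _))

  Sum-map : (g : B → A) (xs : List B) (f : A → ℚ) → Sum (List.map g xs) f ≡ Sum xs (f ∘ g)
  Sum-map g []       f = refl
  Sum-map g (x ∷ xs) f = cong (f (g x) +_) (Sum-map g xs f)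

  Sum-concatMap : (g : B → List A) (xs : List B) (f : A → ℚ) →
    Sum (concatMap g xs) f ≡ Sum xs (λ x → Sum (g x) f)
  Sum-concatMap g []       f = refl
  Sum-concatMap g (x ∷ xs) f = trans (Sum-++ (g x) _ f) (cong (Sum (g x) f +_) (Sum-concatMap g xs f))

  Sum-filter : ∀ {P : A → Set p} (P? : ∀ x → Dec (P x)) (xs : List A) (f : A → ℚ) →
    Sum (filter P? xs) f ≡ Sum xs (λ x → 𝟙 (P? x) * f x)
  Sum-filter P? []       f = refl
  Sum-filter P? (x ∷ xs) f with P? x
  ... | yes _ = cong₂ _+_ (sym (ℚP.*-identityˡ (f x))) (Sum-filter P? xs f)
  ... | no _  = trans (Sum-filter P? xs f)
    (sym (trans (cong (_+ _) (ℚP.*-zeroˡ (f x))) (ℚP.+-identityˡ _)))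

  Sum-1 : (xs : List A) → Sum xs (λ _ → 1ℚ) ≡ ι (length xs)
  Sum-1 []       = refl
  Sum-1 (x ∷ xs) = trans (cong (1ℚ +_) (Sum-1 xs)) (sym (ι-suc (length xs)))

  sumList-map : (f : A → ℚ) (xs : List A) → sumList (List.map f xs) ≡ Sum xs f
  sumList-map f []       = refl
  sumList-map f (x ∷ xs) = cong (f x +_) (sumList-map f xs)

  -- The sum is the number of entries satisfying `P`, and `ι` sends no positive number to 0. This
  -- turns a count back into a statement about every entry.
  Sum-𝟙≡0 : ∀ {P : A → Set p} (P? : ∀ x → Dec (P x)) (xs : List A) →
    Sum xs (λ x → 𝟙 (P? x)) ≡ 0ℚ → ∀ {x} → x ∈ xs → ¬ P x
  Sum-𝟙≡0 P? xs eq x∈xs px = ι≢0 (length (filter P? xs)) (λ len → nonempty (filter P? xs) len (∈-filter⁺ P? x∈xs px))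
    (trans (trans (sym (Sum-1 (filter P? xs)))
      (trans (Sum-filter P? xs (λ _ → 1ℚ)) (Sum-cong xs (λ x → ℚP.*-identityʳ (𝟙 (P? x)))))) eq)
    where
    nonempty : ∀ {x} (ys : List A) → length ys ≡ 0 → ¬ x ∈ ys
    nonempty (y ∷ ys) () (here _)
    nonempty (y ∷ ys) () (there _)

-- Finite types and their enumerations.

-- `once` combines completeness and absence of repetition in the form that sums consume: `x ≟ a`
-- acts as a Kronecker delta.
record Finite (A : Set) : Set where
  infix 4 _≟_
  field
    elements : List A
    _≟_      : DecidableEquality A
    once     : ∀ a → Sum elements (λ x → 𝟙 (x ≟ a)) ≡ 1ℚ

  sift : ∀ a (f : A → ℚ) → Sum elements (λ x → 𝟙 (x ≟ a) * f x) ≡ f a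
  sift a f = begin
    Sum elements (λ x → 𝟙 (x ≟ a) * f x) ≡⟨ Sum-cong elements (λ x → 𝟙-*-cong (x ≟ a) (cong f)) ⟩
    Sum elements (λ x → 𝟙 (x ≟ a) * f a) ≡⟨ Sum-*ʳ elements (f a) (λ x → 𝟙 (x ≟ a)) ⟩
    Sum elements (λ x → 𝟙 (x ≟ a)) * f a ≡⟨ cong (_* f a) (once a) ⟩
    1ℚ * f a                             ≡⟨ ℚP.*-identityˡ (f a) ⟩
    f a                                  ∎
    where open ≡-Reasoning

  -- If `a` were missing, every indicator in `once a` would vanish and give 1 = 0.
  complete : ∀ a → a ∈ elements
  complete a with Any.any? (a ≟_) elements
  ... | yes a∈ = a∈
  ... | no a∉  = contradiction (trans (sym (once a)) (trans (Sum-cong-∈ elements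
          (λ {x} x∈ → 𝟙-no (x ≟ a) (λ eq → a∉ (lose x∈ (sym eq))))) (Sum-0 elements))) (λ ())

  ∃? : ∀ {p} {P : A → Set p} → (∀ x → Dec (P x)) → Dec (∃ P)
  ∃? P? = Dec.map′ Any.satisfied (λ (x , px) → lose (complete x) px) (Any.any? P? elements)

  ∀? : ∀ {p} {P : A → Set p} → (∀ x → Dec (P x)) → Dec (∀ x → P x)
  ∀? P? = Dec.map′ (λ all x → All.lookup all (complete x)) (λ all → All.tabulate (λ {x} _ → all x)) (All.all? P? elements)

open Finite using (elements; once; sift; complete; ∃?; ∀?)

module _ {A B : Set} (𝔸 : Finite A) (𝔹 : Finite B) where
  private
    module A = Finite 𝔸
    module B = Finite 𝔹

  -- Both sides sum `f y` over the graph of the bijection, in the two possible orders.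
  reindex : (φ : A → B) (ψ : B → A) → (∀ x → ψ (φ x) ≡ x) → (∀ y → φ (ψ y) ≡ y) →
    (f : B → ℚ) → Sum (elements 𝔸) (f ∘ φ) ≡ Sum (elements 𝔹) f
  reindex φ ψ ψφ φψ f = begin
    Sum A.elements (f ∘ φ)
      ≡⟨ Sum-cong A.elements (λ x → B.sift (φ x) f) ⟨
    Sum A.elements (λ x → Sum B.elements (λ y → 𝟙 (y B.≟ φ x) * f y))
      ≡⟨ Sum-swap A.elements B.elements _ ⟩
    Sum B.elements (λ y → Sum A.elements (λ x → 𝟙 (y B.≟ φ x) * f y))
      ≡⟨ Sum-cong B.elements (λ y → trans
           (Sum-cong A.elements (λ x → cong (_* f y) (𝟙-⇔ (y B.≟ φ x) (x A.≟ ψ y)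
             (λ eq → sym (trans (cong ψ eq) (ψφ x))) (λ eq → sym (trans (cong φ eq) (φψ y))))))
           (A.sift (ψ y) (λ _ → f y))) ⟩
    Sum B.elements f ∎
    where open ≡-Reasoning

  Sum-pairs : (f : A × B → ℚ) → Sum (concatMap (λ x → List.map (x ,_) B.elements) A.elements) f
    ≡ Sum A.elements (λ x → Sum B.elements (λ y → f (x , y)))
  Sum-pairs f = trans (Sum-concatMap (λ x → List.map (x ,_) B.elements) A.elements f)
    (Sum-cong A.elements (λ x → Sum-map (x ,_) B.elements f))

  pairs : Finite (A × B)
  pairs = record
    { elements = concatMap (λ x → List.map (x ,_) B.elements) A.elements
    ; _≟_      = _≟₂_
    ; once     = λ (a , b) → trans (Sum-pairs _)
        (trans (Sum-cong A.elements (λ x →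
           trans (Sum-cong B.elements (λ y → 𝟙-× (x A.≟ a) (y B.≟ b) ((x , y) ≟₂ (a , b)) ,-injective ,-cong))
             (Sum-*ˡ B.elements (𝟙 (x A.≟ a)) _)))
          (trans (A.sift a _) (B.once b)))
    }
    where
    ,-injective : ∀ {x y a b} → (x , y) ≡ (a , b) → x ≡ a × y ≡ b
    ,-injective refl = refl , refl
    ,-cong : ∀ {x y a b} → x ≡ a × y ≡ b → (x , y) ≡ (a , b)
    ,-cong (refl , refl) = refl
    _≟₂_ : DecidableEquality (A × B)
    (x , y) ≟₂ (a , b) = Dec.map′ ,-cong ,-injective (x A.≟ a ×-dec y B.≟ b)

words : ∀ {A : Set} → List A → (n : ℕ) → List (Vec A n)
words xs zero    = [] ∷ []
words xs (suc n) = concatMap (λ x → List.map (x ∷_) (words xs n)) xs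

Sum-words : ∀ {A : Set} (xs : List A) n (f : Vec A (suc n) → ℚ) →
  Sum (words xs (suc n)) f ≡ Sum xs (λ x → Sum (words xs n) (λ v → f (x ∷ v)))
Sum-words xs n f = trans (Sum-concatMap (λ x → List.map (x ∷_) (words xs n)) xs f)
  (Sum-cong xs (λ x → Sum-map (x ∷_) (words xs n) f))

length-words : ∀ {A : Set} (xs : List A) n → Sum (words xs n) (λ _ → 1ℚ) ≡ ι (length xs ℕ.^ n)
length-words xs zero    = refl
length-words xs (suc n) = trans (Sum-words xs n (λ _ → 1ℚ)) (trans (Sum-cong xs (λ x → length-words xs n))
  (trans (trans (Sum-cong xs (λ _ → sym (ℚP.*-identityˡ _))) (trans (Sum-*ʳ xs _ (λ _ → 1ℚ)) (cong (_* ι (length xs ℕ.^ n)) (Sum-1 xs))))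
    (sym (ι-* (length xs) _))))

vecs-finite : ∀ {A} → Finite A → ∀ n → Finite (Vec A n)
vecs-finite {A} 𝔸 n = record { elements = words A.elements n ; _≟_ = _≟ᵥ_ ; once = once′ }
  where
  module A = Finite 𝔸
  _≟ᵥ_ : ∀ {n} → DecidableEquality (Vec A n)
  _≟ᵥ_ = VecP.≡-dec A._≟_
  once′ : ∀ {n} (v : Vec A n) → Sum (words A.elements n) (λ w → 𝟙 (w ≟ᵥ v)) ≡ 1ℚ
  once′ []      = refl
  once′ {suc n} (a ∷ v) = trans (Sum-words A.elements n _)
    (trans (Sum-cong A.elements (λ x →
      trans (Sum-cong (words A.elements n) (λ w → 𝟙-× (x A.≟ a) (w ≟ᵥ v) ((x ∷ w) ≟ᵥ (a ∷ v))
              VecP.∷-injective (λ (p , q) → cong₂ _∷_ p q)))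
        (Sum-*ˡ (words A.elements n) (𝟙 (x A.≟ a)) _)))
      (trans (A.sift a _) (once′ v)))

Sum-tabulate : ∀ {a} {A : Set a} n (g : Fin n → A) (f : A → ℚ) → Sum (List.tabulate g) f ≡ Sum (allFin n) (f ∘ g)
Sum-tabulate zero    g f = refl
Sum-tabulate (suc n) g f = cong (f (g Fin.zero) +_)
  (trans (Sum-tabulate n (g ∘ Fin.suc) f) (sym (Sum-tabulate n Fin.suc (f ∘ g))))

Sum-allFin : ∀ n (f : Fin (suc n) → ℚ) → Sum (allFin (suc n)) f ≡ f Fin.zero + Sum (allFin n) (f ∘ Fin.suc)
Sum-allFin n f = cong (f Fin.zero +_) (Sum-tabulate n Fin.suc f)

fins : ∀ n → Finite (Fin n)
fins n = record { elements = allFin n ; _≟_ = Fin._≟_ ; once = once′ n }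
  where
  once′ : ∀ n (a : Fin n) → Sum (allFin n) (λ x → 𝟙 (x Fin.≟ a)) ≡ 1ℚ
  once′ (suc n) Fin.zero = trans (Sum-allFin n (λ x → 𝟙 (x Fin.≟ Fin.zero)))
    (cong (1ℚ +_) (Sum-zero (allFin n) (λ x → 𝟙-no (Fin.suc x Fin.≟ Fin.zero) (λ ()))))
  once′ (suc n) (Fin.suc a) = trans (Sum-allFin n (λ x → 𝟙 (x Fin.≟ Fin.suc a))) (trans (ℚP.+-identityˡ _)
    (trans (Sum-cong (allFin n) (λ x → 𝟙-⇔ (Fin.suc x Fin.≟ Fin.suc a) (x Fin.≟ a) FinP.suc-injective (cong Fin.suc)))
      (once′ n a)))

-- Burnside's lemma on an invariant subset.

-- The group laws appear in the form in which they are used: `∙-∙inv` and `∙inv-∙` make right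
-- translation by `h` a bijection of `G`.
module Burnside {A G : Set} (𝔸 : Finite A) (𝔾 : Finite G)
  (_∙_ : G → G → G) (ε : G) (inv : G → G) (act : G → A → A)
  (act-∙ : ∀ g h x → act (g ∙ h) x ≡ act g (act h x))
  (act-ε : ∀ x → act ε x ≡ x)
  (act-inv : ∀ g x → act (inv g) (act g x) ≡ x)
  (∙-∙inv : ∀ h g → (g ∙ h) ∙ inv h ≡ g)
  (∙inv-∙ : ∀ h g → (g ∙ inv h) ∙ h ≡ g)
  (Q : A → Set) (Q? : ∀ x → Dec (Q x)) (Q-act : ∀ g {x} → Q x → Q (act g x))
  where

  private
    module 𝔸 = Finite 𝔸
  open 𝔸 using (_≟_)

  _~_ : A → A → Set
  x ~ y = ∃ λ g → act g x ≡ y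

  _~?_ : ∀ x y → Dec (x ~ y)
  x ~? y = ∃? 𝔾 (λ g → act g x ≟ y)

  ~-sym : ∀ {x y} → x ~ y → y ~ x
  ~-sym {x} (g , refl) = inv g , act-inv g x

  ~-trans : ∀ {x y z} → x ~ y → y ~ z → x ~ z
  ~-trans {x} (g , refl) (h , refl) = h ∙ g , act-∙ h g x

  orbits : DecSetoid _ _
  orbits = record
    { isDecEquivalence = record
      { isEquivalence = record { refl = λ {x} → ε , act-ε x ; sym = ~-sym ; trans = ~-trans }
      ; _≟_ = _~?_ } }

  points reps : List A
  points = filter Q? 𝔸.elements
  reps   = deduplicate _~?_ points

  reps-Q : All Q reps
  reps-Q = AllP.deduplicate⁺ _~?_ (AllP.all-filter Q? 𝔸.elements)

  reps-distinct : AllPairs (λ x y → ¬ x ~ y) reps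
  reps-distinct = UniqueP.deduplicate-! orbits points

  reps-cover : ∀ x → Q x → Any (_~ x) reps
  reps-cover x qx = AnyP.deduplicate⁺ _~?_ (λ y~x x~z → ~-trans y~x x~z)
    (lose (∈-filter⁺ Q? (𝔸.complete x) qx) (ε , act-ε x))

  private
    unique-rep : ∀ rs x → AllPairs (λ x y → ¬ x ~ y) rs → Any (_~ x) rs → Sum rs (λ r → 𝟙 (r ~? x)) ≡ 1ℚ
    unique-rep (r ∷ rs) x (r≁ ∷ _) (here r~x) = cong₂ _+_ (𝟙-yes (r ~? x) r~x)
      (trans (Sum-cong-∈ rs (λ {y} y∈ → 𝟙-no (y ~? x) (λ y~x → All.lookup r≁ y∈ (~-trans r~x (~-sym y~x)))))
        (Sum-0 rs))
    unique-rep (r ∷ rs) x (r≁ ∷ distinct) (there x∈) = trans (cong₂ _+_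
      (𝟙-no (r ~? x) (λ r~x → let y , y∈ , y~x = find x∈ in All.lookup r≁ y∈ (~-trans r~x (~-sym y~x))))
      (unique-rep rs x distinct x∈)) (ℚP.+-identityˡ 1ℚ)

    stab : A → ℚ
    stab x = Sum (elements 𝔾) (λ g → 𝟙 (act g x ≟ x))

    -- If `h` carries `r` to `x`, right translation by `h` maps the stabiliser of `x` onto the set
    -- of elements carrying `r` to `x`.
    stab-transporter : ∀ r x → 𝟙 (r ~? x) * stab x ≡ Sum (elements 𝔾) (λ g → 𝟙 (act g r ≟ x))
    stab-transporter r x with r ~? x
    ... | yes (h , hr≡x) = begin
      1ℚ * stab x
        ≡⟨ ℚP.*-identityˡ (stab x) ⟩
      stab x
        ≡⟨ Sum-cong (elements 𝔾) (λ g → 𝟙-⇔ (act g x ≟ x) (act (g ∙ h) r ≟ x)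
             (trans (eq g)) (trans (sym (eq g)))) ⟩
      Sum (elements 𝔾) (λ g → 𝟙 (act (g ∙ h) r ≟ x))
        ≡⟨ reindex 𝔾 𝔾 (_∙ h) (_∙ inv h) (∙-∙inv h) (∙inv-∙ h) (λ g → 𝟙 (act g r ≟ x)) ⟩
      Sum (elements 𝔾) (λ g → 𝟙 (act g r ≟ x)) ∎
      where
      open ≡-Reasoning
      eq : ∀ g → act (g ∙ h) r ≡ act g x
      eq g = trans (act-∙ g h r) (cong (act g) hr≡x)
    ... | no r≁x = trans (ℚP.*-zeroˡ (stab x))
      (sym (Sum-zero (elements 𝔾) (λ g → 𝟙-no (act g r ≟ x) (λ eq → r≁x (g , eq)))))

    hit : ∀ {x} → Q x → Sum points (λ y → 𝟙 (x ≟ y)) ≡ 1ℚ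
    hit {x} qx = begin
      Sum points (λ y → 𝟙 (x ≟ y))
        ≡⟨ Sum-filter Q? 𝔸.elements _ ⟩
      Sum 𝔸.elements (λ y → 𝟙 (Q? y) * 𝟙 (x ≟ y))
        ≡⟨ Sum-cong 𝔸.elements (λ y → trans (ℚP.*-comm (𝟙 (Q? y)) _)
             (cong (_* 𝟙 (Q? y)) (𝟙-⇔ (x ≟ y) (y ≟ x) sym sym))) ⟩
      Sum 𝔸.elements (λ y → 𝟙 (y ≟ x) * 𝟙 (Q? y))
        ≡⟨ 𝔸.sift x (λ y → 𝟙 (Q? y)) ⟩
      𝟙 (Q? x)
        ≡⟨ 𝟙-yes (Q? x) qx ⟩
      1ℚ ∎
      where open ≡-Reasoning

  -- The stabiliser of `x` is replaced by the elements carrying the unique representative of its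
  -- orbit to `x`. Summed over all `x`, each representative then accounts for every group element
  -- once, so orbit sizes and division never enter.
  burnside : ι (length reps) * Sum (elements 𝔾) (λ _ → 1ℚ)
    ≡ Sum (elements 𝔾) (λ g → Sum 𝔸.elements (λ x → 𝟙 (Q? x) * 𝟙 (act g x ≟ x)))
  burnside = sym (begin
    Sum Gs (λ g → Sum 𝔸.elements (λ x → 𝟙 (Q? x) * 𝟙 (act g x ≟ x)))
      ≡⟨ Sum-swap Gs 𝔸.elements _ ⟩
    Sum 𝔸.elements (λ x → Sum Gs (λ g → 𝟙 (Q? x) * 𝟙 (act g x ≟ x)))
      ≡⟨ Sum-cong 𝔸.elements (λ x → Sum-*ˡ Gs (𝟙 (Q? x)) _) ⟩
    Sum 𝔸.elements (λ x → 𝟙 (Q? x) * stab x)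
      ≡⟨ Sum-filter Q? 𝔸.elements stab ⟨
    Sum points stab
      ≡⟨ Sum-cong-∈ points (λ {x} x∈ → trans (sym (ℚP.*-identityˡ (stab x)))
           (trans (cong (_* stab x) (sym (unique-rep reps x reps-distinct (reps-cover x (proj₂ (∈-filter⁻ Q? {xs = 𝔸.elements} x∈))))))
             (trans (sym (Sum-*ʳ reps (stab x) _)) (Sum-cong reps (λ r → stab-transporter r x))))) ⟩
    Sum points (λ x → Sum reps (λ r → Sum Gs (λ g → 𝟙 (act g r ≟ x))))
      ≡⟨ Sum-swap points reps _ ⟩
    Sum reps (λ r → Sum points (λ x → Sum Gs (λ g → 𝟙 (act g r ≟ x))))
      ≡⟨ Sum-cong reps (λ r → Sum-swap points Gs _) ⟩
    Sum reps (λ r → Sum Gs (λ g → Sum points (λ x → 𝟙 (act g r ≟ x))))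
      -- For fixed `g` and `r` exactly one point equals `act g r`, and it is listed because `Q` is
      -- invariant.
      ≡⟨ Sum-cong-∈ reps (λ r∈ → Sum-cong Gs (λ g → hit (Q-act g (All.lookup reps-Q r∈)))) ⟩
    Sum reps (λ _ → Sum Gs (λ _ → 1ℚ))
      ≡⟨ Sum-cong reps (λ _ → ℚP.*-identityˡ _) ⟨
    Sum reps (λ _ → 1ℚ * Sum Gs (λ _ → 1ℚ))
      ≡⟨ Sum-*ʳ reps _ _ ⟩
    Sum reps (λ _ → 1ℚ) * Sum Gs (λ _ → 1ℚ)
      ≡⟨ cong (_* Sum Gs (λ _ → 1ℚ)) (Sum-1 reps) ⟩
    ι (length reps) * Sum Gs (λ _ → 1ℚ) ∎)
    where
    open ≡-Reasoning
    Gs = elements 𝔾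

-- Reciprocals, factorials and finite products.

÷'-inverse : ∀ r → r ≢ 0ℚ → r * (1ℚ ÷' r) ≡ 1ℚ
÷'-inverse r r≢0 with r ℚP.≟ 0ℚ
... | yes r≡0 = contradiction r≡0 r≢0
... | no r≢0′ = trans (cong (r *_) (ℚP.*-identityˡ _)) (ℚP.*-inverseʳ r {{≢-nonZero r≢0′}})

-- True for the divisor 0 as well, where both sides take the default value 0.
÷'-* : ∀ p r → p ÷' r ≡ p * (1ℚ ÷' r)
÷'-* p r with r ℚP.≟ 0ℚ
... | yes _  = sym (ℚP.*-zeroʳ p)
... | no r≢0 = cong (p *_) (sym (ℚP.*-identityˡ _))

÷'-unique : ∀ {r} x → r ≢ 0ℚ → r * x ≡ 1ℚ → 1ℚ ÷' r ≡ x
÷'-unique {r} x r≢0 rx≡1 = begin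
  1ℚ ÷' r              ≡⟨ ℚP.*-identityˡ _ ⟨
  1ℚ * (1ℚ ÷' r)       ≡⟨ cong (_* (1ℚ ÷' r)) rx≡1 ⟨
  (r * x) * (1ℚ ÷' r)  ≡⟨ solve 3 (λ r x y → (r :* x) :* y := x :* (r :* y)) refl r x (1ℚ ÷' r) ⟩
  x * (r * (1ℚ ÷' r))  ≡⟨ cong (x *_) (÷'-inverse r r≢0) ⟩
  x * 1ℚ               ≡⟨ ℚP.*-identityʳ x ⟩
  x                    ∎
  where open ≡-Reasoning; open +-*-Solver

1/! : ℕ → ℚ
1/! k = 1ℚ ÷' ι (k !)

!≢0 : ∀ k → ι (k !) ≢ 0ℚ
!≢0 k = ι≢0 (k !) (ℕ.≢-nonZero⁻¹ (k !) {{k ℕP.!≢0}})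

!-1/! : ∀ k → ι (k !) * 1/! k ≡ 1ℚ
!-1/! k = ÷'-inverse (ι (k !)) (!≢0 k)

suc-1/! : ∀ k → ι (suc k) * 1/! (suc k) ≡ 1/! k
suc-1/! k = sym (÷'-unique (ι (suc k) * 1/! (suc k)) (!≢0 k) (begin
  ι (k !) * (ι (suc k) * 1/! (suc k))  ≡⟨ solve 3 (λ a b c → a :* (b :* c) := (b :* a) :* c) refl (ι (k !)) (ι (suc k)) (1/! (suc k)) ⟩
  ι (suc k) * ι (k !) * 1/! (suc k)    ≡⟨ cong (_* 1/! (suc k)) (ι-* (suc k) (k !)) ⟨
  ι (suc k !) * 1/! (suc k)            ≡⟨ !-1/! (suc k) ⟩
  1ℚ                                   ∎))
  where open ≡-Reasoning; open +-*-Solver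

prodFrom-cong : ∀ a n {f g : ℕ → ℚ} → (∀ i → f i ≡ g i) → prodFrom a n f ≡ prodFrom a n g
prodFrom-cong a zero    eq = refl
prodFrom-cong a (suc n) eq = cong₂ _*_ (eq a) (prodFrom-cong (suc a) n eq)

prodFrom-last : ∀ a n f → prodFrom a (suc n) f ≡ prodFrom a n f * f (a ℕ.+ n)
prodFrom-last a zero    f = trans (ℚP.*-comm (f a) 1ℚ) (cong (λ k → 1ℚ * f k) (sym (ℕP.+-identityʳ a)))
prodFrom-last a (suc n) f = trans (cong (f a *_) (prodFrom-last (suc a) n f))
  (trans (sym (ℚP.*-assoc (f a) _ _)) (cong (λ k → f a * prodFrom (suc a) n f * f k) (sym (ℕP.+-suc a n))))

prodFrom-zero : ∀ a n f k → k ℕ.< n → f (a ℕ.+ k) ≡ 0ℚ → prodFrom a n f ≡ 0ℚ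
prodFrom-zero a (suc n) f zero    _         eq = trans (cong (_* prodFrom (suc a) n f) (trans (cong f (sym (ℕP.+-identityʳ a))) eq)) (ℚP.*-zeroˡ (prodFrom (suc a) n f))
prodFrom-zero a (suc n) f (suc k) (s≤s k<n) eq = trans
  (cong (f a *_) (prodFrom-zero (suc a) n f k k<n (trans (cong f (sym (ℕP.+-suc a k))) eq))) (ℚP.*-zeroʳ (f a))

-- Binomial sums and Cauchy products.

-- ∑ᵢ C(n,i) G i (n - i), presented through Pascal's rule so that no binomial coefficient occurs.
binomial : ℕ → (ℕ → ℕ → ℚ) → ℚ
binomial zero    G = G 0 0
binomial (suc n) G = binomial n (λ i j → G (suc i) j) + binomial n (λ i j → G i (suc j))

binomial-cong : ∀ n {G H : ℕ → ℕ → ℚ} → (∀ i j → i ℕ.+ j ≡ n → G i j ≡ H i j) → binomial n G ≡ binomial n H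
binomial-cong zero    eq = eq 0 0 refl
binomial-cong (suc n) eq = cong₂ _+_ (binomial-cong n (λ i j p → eq (suc i) j (cong suc p)))
  (binomial-cong n (λ i j p → eq i (suc j) (trans (ℕP.+-suc i j) (cong suc p))))

binomial-Sum : ∀ n {A : Set} (xs : List A) (G : A → ℕ → ℕ → ℚ) →
  Sum xs (λ x → binomial n (G x)) ≡ binomial n (λ i j → Sum xs (λ x → G x i j))
binomial-Sum zero    xs G = refl
binomial-Sum (suc n) xs G = trans (Sum-+ xs _ _)
  (cong₂ _+_ (binomial-Sum n xs (λ x i j → G x (suc i) j)) (binomial-Sum n xs (λ x i j → G x i (suc j))))

binomial-0 : ∀ n → binomial n (λ _ _ → 0ℚ) ≡ 0ℚ
binomial-0 zero    = refl
binomial-0 (suc n) = cong₂ _+_ (binomial-0 n) (binomial-0 n)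

convolution : ℕ → (ℕ → ℕ → ℚ) → ℚ
convolution zero    G = G 0 0
convolution (suc n) G = G 0 (suc n) + convolution n (λ i j → G (suc i) j)

convolution-cong : ∀ n {G H : ℕ → ℕ → ℚ} → (∀ i j → i ℕ.+ j ≡ n → G i j ≡ H i j) → convolution n G ≡ convolution n H
convolution-cong zero    eq = eq 0 0 refl
convolution-cong (suc n) eq = cong₂ _+_ (eq 0 (suc n) refl) (convolution-cong n (λ i j p → eq (suc i) j (cong suc p)))

convolution-+ : ∀ n (G H : ℕ → ℕ → ℚ) → convolution n (λ i j → G i j + H i j) ≡ convolution n G + convolution n H
convolution-+ zero    G H = refl
convolution-+ (suc n) G H = trans (cong (G 0 (suc n) + H 0 (suc n) +_) (convolution-+ n (λ i → G (suc i)) (λ i → H (suc i))))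
  (solve 4 (λ a b c d → (a :+ b) :+ (c :+ d) := (a :+ c) :+ (b :+ d)) refl (G 0 (suc n)) (H 0 (suc n)) (convolution n (λ i → G (suc i))) (convolution n (λ i → H (suc i))))
  where open +-*-Solver

convolution-*ˡ : ∀ n c (G : ℕ → ℕ → ℚ) → convolution n (λ i j → c * G i j) ≡ c * convolution n G
convolution-*ˡ zero    c G = refl
convolution-*ˡ (suc n) c G = trans (cong (c * G 0 (suc n) +_) (convolution-*ˡ n c _)) (sym (ℚP.*-distribˡ-+ c _ _))

convolution-last : ∀ n G → convolution (suc n) G ≡ convolution n (λ i j → G i (suc j)) + G (suc n) 0
convolution-last zero    G = refl
convolution-last (suc n) G = trans (cong (G 0 (suc (suc n)) +_) (convolution-last n (λ i → G (suc i)))) (sym (ℚP.+-assoc (G 0 (suc (suc n))) _ _))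

convolution-single : ∀ n i₀ j₀ (G : ℕ → ℕ → ℚ) → i₀ ℕ.+ j₀ ≡ n →
  (∀ i j → i ℕ.+ j ≡ n → i ≢ i₀ → G i j ≡ 0ℚ) → convolution n G ≡ G i₀ j₀
convolution-single zero    zero     .0 G refl _ = refl
convolution-single (suc n) zero     .(suc n) G refl zeros = trans (cong (G 0 (suc n) +_)
  (trans (convolution-cong n (λ i j p → zeros (suc i) j (cong suc p) (λ ()))) (zero-sum n))) (ℚP.+-identityʳ _)
  where
  zero-sum : ∀ n → convolution n (λ _ _ → 0ℚ) ≡ 0ℚ
  zero-sum zero    = refl
  zero-sum (suc n) = cong (0ℚ +_) (zero-sum n)
convolution-single (suc n) (suc i₀) j₀ G p zeros = trans
  (cong₂ _+_ (zeros 0 (suc n) refl (λ ()))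
    (convolution-single n i₀ j₀ _ (ℕP.suc-injective p) (λ i j q i≢ → zeros (suc i) j (cong suc q) (i≢ ∘ ℕP.suc-injective))))
  (ℚP.+-identityˡ _)

-- Pascal's rule for reciprocal factorials: with `suc n = i + j` under the sum, the factor `i` turns
-- `1/! i` into the reciprocal factorial of its predecessor, the factor `j` does the same for
-- `1/! j`, and these are the two halves of `binomial (suc n)`.
binomial-convolution : ∀ n G → binomial n G ≡ ι (n !) * convolution n (λ i j → 1/! i * 1/! j * G i j)
binomial-convolution zero    G = sym (trans (ℚP.*-identityˡ _) (ℚP.*-identityˡ (G 0 0)))
binomial-convolution (suc n) G = begin
  binomial n (λ i j → G (suc i) j) + binomial n (λ i j → G i (suc j))
    ≡⟨ cong₂ _+_ (binomial-convolution n _) (binomial-convolution n _) ⟩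
  ι (n !) * convolution n (λ i j → 1/! i * 1/! j * G (suc i) j) + ι (n !) * convolution n (λ i j → 1/! i * 1/! j * G i (suc j))
    ≡⟨ ℚP.*-distribˡ-+ (ι (n !)) _ _ ⟨
  ι (n !) * (convolution n (λ i j → 1/! i * 1/! j * G (suc i) j) + convolution n (λ i j → 1/! i * 1/! j * G i (suc j)))
    ≡⟨ cong (ι (n !) *_) (cong₂ _+_ left right) ⟨
  ι (n !) * (convolution (suc n) (λ i j → ι i * H i j) + convolution (suc n) (λ i j → ι j * H i j))
    ≡⟨ cong (ι (n !) *_) (convolution-+ (suc n) (λ i j → ι i * H i j) (λ i j → ι j * H i j)) ⟨
  ι (n !) * convolution (suc n) (λ i j → ι i * H i j + ι j * H i j)
    ≡⟨ cong (ι (n !) *_) (convolution-cong (suc n) (λ i j p →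
         trans (sym (ℚP.*-distribʳ-+ (H i j) (ι i) (ι j))) (cong (_* H i j) (trans (sym (ι-+ i j)) (cong ι p))))) ⟩
  ι (n !) * convolution (suc n) (λ i j → ι (suc n) * H i j)
    ≡⟨ cong (ι (n !) *_) (convolution-*ˡ (suc n) (ι (suc n)) H) ⟩
  ι (n !) * (ι (suc n) * convolution (suc n) H)
    ≡⟨ solve 3 (λ a b c → a :* (b :* c) := (b :* a) :* c) refl (ι (n !)) (ι (suc n)) (convolution (suc n) H) ⟩
  ι (suc n) * ι (n !) * convolution (suc n) H
    ≡⟨ cong (_* convolution (suc n) H) (ι-* (suc n) (n !)) ⟨
  ι (suc n !) * convolution (suc n) H ∎
  where
  open ≡-Reasoning
  open +-*-Solver
  H : ℕ → ℕ → ℚ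
  H i j = 1/! i * 1/! j * G i j
  left : convolution (suc n) (λ i j → ι i * H i j) ≡ convolution n (λ i j → 1/! i * 1/! j * G (suc i) j)
  left = trans (cong (_+ convolution n (λ i j → ι (suc i) * H (suc i) j)) (ℚP.*-zeroˡ (H 0 (suc n)))) (trans (ℚP.+-identityˡ _)
    (convolution-cong n (λ i j _ → trans
      (solve 4 (λ s u v w → s :* (u :* v :* w) := s :* u :* v :* w) refl (ι (suc i)) (1/! (suc i)) (1/! j) (G (suc i) j))
      (cong (λ z → z * 1/! j * G (suc i) j) (suc-1/! i)))))
  right : convolution (suc n) (λ i j → ι j * H i j) ≡ convolution n (λ i j → 1/! i * 1/! j * G i (suc j))
  right = trans (convolution-last n (λ i j → ι j * H i j)) (trans (cong (convolution n (λ i j → ι (suc j) * H i (suc j)) +_) (ℚP.*-zeroˡ (H (suc n) 0)))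
    (trans (ℚP.+-identityʳ _) (convolution-cong n (λ i j _ → trans
      (solve 4 (λ s u v w → s :* (u :* v :* w) := u :* (s :* v) :* w) refl (ι (suc j)) (1/! i) (1/! (suc j)) (G i (suc j)))
      (cong (λ z → 1/! i * z * G i (suc j)) (suc-1/! j))))))

-- Colourings and their colour counts.

bump : ∀ {s} → Fin s → Vec ℕ s → Vec ℕ s
bump Fin.zero    (k ∷ ks) = suc k ∷ ks
bump (Fin.suc c) (k ∷ ks) = k ∷ bump c ks

counts : ∀ {s n} → Vec (Fin s) n → Vec ℕ s
counts {s} []  = Vec.replicate s 0
counts (c ∷ d) = bump c (counts d)

count : ∀ {s n} → Fin s → Vec (Fin s) n → ℕ
count c d = lookup (counts d) c

lookup-bump-≡ : ∀ {s} (c : Fin s) ks → lookup (bump c ks) c ≡ suc (lookup ks c)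
lookup-bump-≡ Fin.zero    (k ∷ ks) = refl
lookup-bump-≡ (Fin.suc c) (k ∷ ks) = lookup-bump-≡ c ks

lookup-bump-≢ : ∀ {s} (c c′ : Fin s) ks → c′ ≢ c → lookup (bump c ks) c′ ≡ lookup ks c′
lookup-bump-≢ Fin.zero    Fin.zero     (k ∷ ks) c≢ = contradiction refl c≢
lookup-bump-≢ Fin.zero    (Fin.suc c′) (k ∷ ks) c≢ = refl
lookup-bump-≢ (Fin.suc c) Fin.zero     (k ∷ ks) c≢ = refl
lookup-bump-≢ (Fin.suc c) (Fin.suc c′) (k ∷ ks) c≢ = lookup-bump-≢ c c′ ks (c≢ ∘ cong Fin.suc)

-- Equivalently a sum over count vectors weighted by multinomial coefficients; summing over words
-- keeps those coefficients out of the formulas.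
∑counts : ∀ s n → (Vec ℕ s → ℚ) → ℚ
∑counts s n f = Sum (words (allFin s) n) (f ∘ counts)

∑counts-cong : ∀ s n {f g : Vec ℕ s → ℚ} → (∀ k → f k ≡ g k) → ∑counts s n f ≡ ∑counts s n g
∑counts-cong s n eq = Sum-cong (words (allFin s) n) (λ d → eq (counts d))

∑counts-suc : ∀ s n f → ∑counts s (suc n) f ≡ Sum (allFin s) (λ c → ∑counts s n (f ∘ bump c))
∑counts-suc s n f = Sum-words (allFin s) n (f ∘ counts)

-- A first letter of colour zero raises `i`, any other first letter lengthens the word in the
-- remaining colours. These are the two branches of `binomial`.
∑counts-split : ∀ s n f → ∑counts (suc s) n f ≡ binomial n (λ i j → ∑counts s j (λ k → f (i ∷ k)))
∑counts-split s zero    f = refl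
∑counts-split s (suc n) f = begin
  ∑counts (suc s) (suc n) f
    ≡⟨ ∑counts-suc (suc s) n f ⟩
  Sum (allFin (suc s)) (λ c → ∑counts (suc s) n (f ∘ bump c))
    ≡⟨ Sum-allFin s (λ c → ∑counts (suc s) n (f ∘ bump c)) ⟩
  ∑counts (suc s) n (f ∘ bump Fin.zero) + Sum (allFin s) (λ c → ∑counts (suc s) n (f ∘ bump (Fin.suc c)))
    ≡⟨ cong₂ _+_ (∑counts-split s n (f ∘ bump Fin.zero))
         (trans (Sum-cong (allFin s) (λ c → ∑counts-split s n (f ∘ bump (Fin.suc c))))
           (trans (binomial-Sum n (allFin s) (λ c i j → ∑counts s j (λ k → f (i ∷ bump c k))))
             (binomial-cong n (λ i j _ → sym (∑counts-suc s j (λ k → f (i ∷ k))))))) ⟩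
  binomial (suc n) (λ i j → ∑counts s j (λ k → f (i ∷ k))) ∎
  where open ≡-Reasoning

-- The colour-by-colour count and its generating recursion.

module Colourings (q : ℕ) where

  Q : ℕ → ℚ
  Q k = ι (q ℕ.^ k)

  -- The number of injective linear maps 𝔽_q^i → 𝔽_q^j; in particular inj k k = |GL_k|.
  inj : ℕ → ℕ → ℚ
  inj i j = prodFrom 0 i (λ t → Q j - Q t)

  inj-suc : ∀ i j → inj (suc i) j ≡ (Q j - Q i) * inj i j
  inj-suc i j = trans (prodFrom-last 0 i (λ t → Q j - Q t)) (ℚP.*-comm (inj i j) _)

  -- The factor at `t = j` is `Q j - Q j`.
  inj-zero : ∀ {i j} → j ℕ.< i → inj i j ≡ 0ℚ
  inj-zero {i} {j} j<i = prodFrom-zero 0 i (λ t → Q j - Q t) j j<i (ℚP.+-inverseʳ (Q j))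

  -- The head of the word is the row chosen last, so `count c d` is the number of earlier rows of
  -- its colour.
  coloured : ∀ {s a b} → Vec (Fin s) a → Vec (Fin s) b → ℚ
  coloured []      e = 1ℚ
  coloured (c ∷ d) e = (Q (count c e) - Q (count c d)) * coloured d e

  block : ∀ {s} → Vec ℕ s → Vec ℕ s → ℚ
  block []       []       = 1ℚ
  block (i ∷ ks) (j ∷ ls) = inj i j * block ks ls

  block-0 : ∀ {s} (ls : Vec ℕ s) → block (Vec.replicate s 0) ls ≡ 1ℚ
  block-0 []       = refl
  block-0 (l ∷ ls) = trans (ℚP.*-identityˡ _) (block-0 ls)

  block-bump : ∀ {s} (c : Fin s) ks ls → block (bump c ks) ls ≡ (Q (lookup ls c) - Q (lookup ks c)) * block ks ls
  block-bump Fin.zero    (i ∷ ks) (j ∷ ls) = trans (cong (_* block ks ls) (inj-suc i j)) (ℚP.*-assoc (Q j - Q i) (inj i j) (block ks ls))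
  block-bump (Fin.suc c) (i ∷ ks) (j ∷ ls) = trans (cong (inj i j *_) (block-bump c ks ls))
    (solve 3 (λ x y z → x :* (y :* z) := y :* (x :* z)) refl (inj i j) (Q (lookup ls c) - Q (lookup ks c)) (block ks ls))
    where open +-*-Solver

  -- The factors are regrouped by colour: successive rows of one colour see 0, 1, 2, ... earlier
  -- rows of that colour, and the resulting product is `inj`.
  coloured-block : ∀ {s a b} (d : Vec (Fin s) a) (e : Vec (Fin s) b) → coloured d e ≡ block (counts d) (counts e)
  coloured-block []      e = sym (block-0 (counts e))
  coloured-block (c ∷ d) e = trans (cong ((Q (count c e) - Q (count c d)) *_) (coloured-block d e))
    (sym (block-bump c (counts d) (counts e)))

  -- Two lengths are kept because removing one colour takes away numbers of rows and columns that
  -- need not agree.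
  total : ℕ → ℕ → ℕ → ℚ
  total s a b = ∑counts s a (λ k → ∑counts s b (λ l → block k l))

  total-suc : ∀ s a b → total (suc s) a b ≡ binomial a (λ i j → binomial b (λ i′ j′ → inj i i′ * total s j j′))
  total-suc s a b = trans (∑counts-split s a (λ k → ∑counts (suc s) b (block k))) (binomial-cong a (λ i j _ → begin
    ∑counts s j (λ k → ∑counts (suc s) b (λ l → block (i ∷ k) l))
      ≡⟨ ∑counts-cong s j (λ k → ∑counts-split s b (λ l → block (i ∷ k) l)) ⟩
    ∑counts s j (λ k → binomial b (λ i′ j′ → ∑counts s j′ (λ l → inj i i′ * block k l)))
      ≡⟨ ∑counts-cong s j (λ k → binomial-cong b (λ i′ j′ _ → Sum-*ˡ (words (allFin s) j′) (inj i i′) (λ e → block k (counts e)))) ⟩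
    ∑counts s j (λ k → binomial b (λ i′ j′ → inj i i′ * ∑counts s j′ (block k)))
      ≡⟨ binomial-Sum b (words (allFin s) j) (λ d i′ j′ → inj i i′ * ∑counts s j′ (block (counts d))) ⟩
    binomial b (λ i′ j′ → ∑counts s j (λ k → inj i i′ * ∑counts s j′ (block k)))
      ≡⟨ binomial-cong b (λ i′ j′ _ → Sum-*ˡ (words (allFin s) j) (inj i i′) (λ d → ∑counts s j′ (block (counts d)))) ⟩
    binomial b (λ i′ j′ → inj i i′ * total s j j′) ∎))
    where open ≡-Reasoning

  -- When rows outnumber columns, they do so in the colour split off or among the remaining colours,
  -- and the corresponding factor vanishes.
  total-zero : ∀ s {a b} → b ℕ.< a → total s a b ≡ 0ℚ
  total-zero zero    {suc a} b<a = refl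
  total-zero (suc s) {a} {b} b<a = trans (total-suc s a b)
    (trans (binomial-cong a (λ i j p → trans (binomial-cong b (λ i′ j′ p′ → zero-term i j i′ j′ p p′)) (binomial-0 b))) (binomial-0 a))
    where
    zero-term : ∀ i j i′ j′ → i ℕ.+ j ≡ a → i′ ℕ.+ j′ ≡ b → inj i i′ * total s j j′ ≡ 0ℚ
    zero-term i j i′ j′ refl refl with i ℕP.≤? i′
    ... | yes i≤i′ = trans (cong (inj i i′ *_) (total-zero s (ℕP.≰⇒> λ j≤j′ → ℕP.<⇒≱ b<a (ℕP.+-mono-≤ i≤i′ j≤j′)))) (ℚP.*-zeroʳ (inj i i′))
    ... | no i≰i′  = trans (cong (_* total s j j′) (inj-zero (ℕP.≰⇒> i≰i′))) (ℚP.*-zeroˡ (total s j j′))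

  g : ℕ → ℚ
  g k = 1/! k * 1/! k * inj k k

  normalised : ℕ → ℕ → ℚ
  normalised s n = 1/! n * 1/! n * total s n n

  normalised-0-suc : ∀ n → normalised 0 (suc n) ≡ 0ℚ
  normalised-0-suc n = ℚP.*-zeroʳ (1/! (suc n) * 1/! (suc n))

  -- The binomial sums over rows and over columns each produce one `n !`, and `normalised` divides
  -- by both. Only `i′ = i` contributes to the inner sum, which turns the double sum into a Cauchy
  -- product.
  normalised-suc : ∀ s n → normalised (suc s) n ≡ convolution n (λ i j → g i * normalised s j)
  normalised-suc s n = begin
    1/! n * 1/! n * total (suc s) n n
      ≡⟨ cong (1/! n * 1/! n *_) (trans (total-suc s n n) (binomial-cong n inner)) ⟩
    1/! n * 1/! n * binomial n (λ i j → ι (n !) * H i j)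
      ≡⟨ cong (1/! n * 1/! n *_) (trans (binomial-convolution n (λ i j → ι (n !) * H i j))
          (cong (ι (n !) *_) (trans (convolution-cong n (λ i j _ → pull i j)) (convolution-*ˡ n (ι (n !)) _)))) ⟩
    1/! n * 1/! n * (ι (n !) * (ι (n !) * C))
      ≡⟨ solve 3 (λ x f c → x :* x :* (f :* (f :* c)) := (f :* x) :* ((f :* x) :* c)) refl (1/! n) (ι (n !)) C ⟩
    ι (n !) * 1/! n * (ι (n !) * 1/! n * C)
      ≡⟨ cong₂ (λ x y → x * (y * C)) (!-1/! n) (!-1/! n) ⟩
    1ℚ * (1ℚ * C)
      ≡⟨ trans (ℚP.*-identityˡ _) (ℚP.*-identityˡ C) ⟩
    C ∎
    where
    open ≡-Reasoning
    open +-*-Solver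
    H : ℕ → ℕ → ℚ
    H i j = 1/! i * 1/! j * (inj i i * total s j j)
    C : ℚ
    C = convolution n (λ i j → g i * normalised s j)
    pull : ∀ i j → 1/! i * 1/! j * (ι (n !) * H i j) ≡ ι (n !) * (g i * normalised s j)
    pull i j = solve 5 (λ x y f z t → x :* y :* (f :* (x :* y :* (z :* t))) := f :* (x :* x :* z :* (y :* y :* t)))
      refl (1/! i) (1/! j) (ι (n !)) (inj i i) (total s j j)
    inner : ∀ i j → i ℕ.+ j ≡ n → binomial n (λ i′ j′ → inj i i′ * total s j j′) ≡ ι (n !) * H i j
    inner i j p = trans (binomial-convolution n (λ i′ j′ → inj i i′ * total s j j′)) (cong (ι (n !) *_)
      (convolution-single n i j (λ i′ j′ → 1/! i′ * 1/! j′ * (inj i i′ * total s j j′)) p (λ i′ j′ p′ i′≢i →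
        trans (cong (1/! i′ * 1/! j′ *_) (off-diagonal i′ j′ (trans p′ (sym p)) i′≢i)) (ℚP.*-zeroʳ (1/! i′ * 1/! j′)))))
      where
      -- If `i′ < i`, the separated colour has more rows than columns. If `i < i′`, the equal sums
      -- give `j′ < j`, and the remaining colours have too many rows.
      off-diagonal : ∀ i′ j′ → i′ ℕ.+ j′ ≡ i ℕ.+ j → i′ ≢ i → inj i i′ * total s j j′ ≡ 0ℚ
      off-diagonal i′ j′ eq i′≢i with ℕP.<-cmp i′ i
      ... | tri< i′<i _ _ = trans (cong (_* total s j j′) (inj-zero i′<i)) (ℚP.*-zeroˡ (total s j j′))
      ... | tri≈ _ i′≡i _ = contradiction i′≡i i′≢i
      ... | tri> _ _ i<i′ = trans (cong (inj i i′ *_) (total-zero s (ℕP.≰⇒> λ j≤j′ →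
              ℕP.<-irrefl (sym eq) (ℕP.+-mono-<-≤ i<i′ j≤j′)))) (ℚP.*-zeroʳ (inj i i′))

-- Sums over multiplicities and part sizes.

Sum-upTo-suc : ∀ n (f : ℕ → ℚ) → Sum (upTo (suc n)) f ≡ f 0 + Sum (upTo n) (f ∘ suc)
Sum-upTo-suc n f = cong (f 0 +_)
  (trans (cong (λ xs → Sum xs f) (sym (ListP.map-upTo suc n))) (Sum-map suc (upTo n) f))

Sum-upTo-last : ∀ n (f : ℕ → ℚ) → Sum (upTo (suc n)) f ≡ Sum (upTo n) f + f n
Sum-upTo-last n f = trans (cong (λ xs → Sum xs f) (sym (ListP.upTo-∷ʳ n)))
  (trans (Sum-++ (upTo n) (n ∷ []) f) (cong (Sum (upTo n) f +_) (ℚP.+-identityʳ (f n))))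

Sum-vecs : ∀ b n (f : Vec ℕ (suc n) → ℚ) →
  Sum (vecs b (suc n)) f ≡ Sum (upTo (suc b)) (λ x → Sum (vecs b n) (λ m → f (x ∷ m)))
Sum-vecs b n f = trans (Sum-concatMap (λ x → List.map (x ∷_) (vecs b n)) (upTo (suc b)) f)
  (Sum-cong (upTo (suc b)) (λ x → Sum-map (x ∷_) (vecs b n) f))

pow : ℚ → ℕ → ℚ
pow y zero    = 1ℚ
pow y (suc n) = y * pow y n

sumFrom : ℕ → ℕ → (ℕ → ℚ) → ℚ
sumFrom a zero    f = 0ℚ
sumFrom a (suc n) f = f a + sumFrom (suc a) n f

sumFrom-cong : ∀ a n {f h : ℕ → ℚ} → (∀ i → f i ≡ h i) → sumFrom a n f ≡ sumFrom a n h
sumFrom-cong a zero    eq = refl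
sumFrom-cong a (suc n) eq = cong₂ _+_ (eq a) (sumFrom-cong (suc a) n eq)

sumFrom-*ˡ : ∀ a n c f → sumFrom a n (λ i → c * f i) ≡ c * sumFrom a n f
sumFrom-*ˡ a zero    c f = sym (ℚP.*-zeroʳ c)
sumFrom-*ˡ a (suc n) c f = trans (cong (c * f a +_) (sumFrom-*ˡ (suc a) n c f)) (sym (ℚP.*-distribˡ-+ c (f a) _))

sumFrom-Sum : ∀ a n {A : Set} (xs : List A) (f : A → ℕ → ℚ) →
  Sum xs (λ x → sumFrom a n (f x)) ≡ sumFrom a n (λ i → Sum xs (λ x → f x i))
sumFrom-Sum a zero    xs f = Sum-0 xs
sumFrom-Sum a (suc n) xs f = trans (Sum-+ xs (λ x → f x a) _) (cong (Sum xs (λ x → f x a) +_) (sumFrom-Sum (suc a) n xs f))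

sumFrom-shift : ∀ a n f → sumFrom (suc a) n f ≡ sumFrom a n (f ∘ suc)
sumFrom-shift a zero    f = refl
sumFrom-shift a (suc n) f = cong (f (suc a) +_) (sumFrom-shift (suc a) n f)

sumFrom-zero : ∀ a n {f : ℕ → ℚ} → (∀ i → a ≤ i → f i ≡ 0ℚ) → sumFrom a n f ≡ 0ℚ
sumFrom-zero a zero    eq = refl
sumFrom-zero a (suc n) eq = cong₂ _+_ (eq a ℕP.≤-refl) (sumFrom-zero (suc a) n (λ i a<i → eq i (ℕP.<⇒≤ a<i)))

-- Part sizes run up to a fixed `L` while the Cauchy product stops at `n`; sizes beyond `n`
-- contribute nothing.
convolution-sumFrom : ∀ n L (f : ℕ → ℚ) (G : ℕ → ℕ → ℚ) → n ≤ L →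
  (∀ i j → i ℕ.+ j ≡ n → f i ≡ G i j) → (∀ i → n ℕ.< i → f i ≡ 0ℚ) → sumFrom 0 (suc L) f ≡ convolution n G
convolution-sumFrom zero    L       f G n≤L eq zeros = trans (cong₂ _+_ (eq 0 0 refl) (sumFrom-zero 1 L zeros)) (ℚP.+-identityʳ _)
convolution-sumFrom (suc n) (suc L) f G (s≤s n≤L) eq zeros = cong₂ _+_ (eq 0 (suc n) refl)
  (trans (sumFrom-shift 0 (suc L) f)
    (convolution-sumFrom n L (f ∘ suc) (λ i → G (suc i)) n≤L (λ i j p → eq (suc i) j (cong suc p)) (λ i n<i → zeros (suc i) (s≤s n<i))))

-- Falling factorials and the marking of a part.

falling : ℕ → ℕ → ℕ
falling s       zero    = 1
falling zero    (suc l) = 0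
falling (suc s) (suc l) = suc s ℕ.* falling s l

-- The definition takes off the largest factor, this equation the smallest. For `l` at least `s`
-- both sides are 0, so the subtraction in the rationals causes no mismatch.
falling-suc : ∀ s l → ι (falling s (suc l)) ≡ (ι s - ι l) * ι (falling s l)
falling-suc zero    zero    = refl
falling-suc zero    (suc l) = sym (ℚP.*-zeroʳ (ι 0 - ι (suc l)))
falling-suc (suc s) zero    = trans (cong ι (ℕP.*-identityʳ (suc s))) (trans (sym (ℚP.+-identityʳ (ι (suc s)))) (sym (ℚP.*-identityʳ _)))
falling-suc (suc s) (suc l) = begin
  ι (suc s ℕ.* falling s (suc l))
    ≡⟨ ι-* (suc s) (falling s (suc l)) ⟩
  ι (suc s) * ι (falling s (suc l))
    ≡⟨ cong (ι (suc s) *_) (falling-suc s l) ⟩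
  ι (suc s) * ((ι s - ι l) * ι (falling s l))
    ≡⟨ solve 4 (λ a b c d → a :* ((b :- c) :* d) := ((con 1ℚ :+ b) :- (con 1ℚ :+ c)) :* (a :* d)) refl (ι (suc s)) (ι s) (ι l) (ι (falling s l)) ⟩
  ((1ℚ + ι s) - (1ℚ + ι l)) * (ι (suc s) * ι (falling s l))
    ≡⟨ cong₂ (λ x y → (x - y) * (ι (suc s) * ι (falling s l))) (ι-suc s) (ι-suc l) ⟨
  (ι (suc s) - ι (suc l)) * (ι (suc s) * ι (falling s l))
    ≡⟨ cong ((ι (suc s) - ι (suc l)) *_) (ι-* (suc s) (falling s l)) ⟨
  (ι (suc s) - ι (suc l)) * ι (suc s ℕ.* falling s l) ∎
  where open ≡-Reasoning; open +-*-Solver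

-- The coefficient chooses one of the parts to mark. `Φ` then sees the number of unmarked parts,
-- while `t` still includes the marked one.
∇ : (ℕ → ℕ → ℚ) → ℕ → ℕ → ℚ
∇ Φ zero    t = 0ℚ
∇ Φ (suc l) t = ι (suc l) * Φ l t

falling-pascal : ∀ s (φ : ℕ → ℚ) l t →
  ι (falling (suc s) l) * φ t ≡ ι (falling s l) * φ t + ∇ (λ l t → ι (falling s l) * φ t) l t
falling-pascal s φ zero    t = sym (ℚP.+-identityʳ _)
falling-pascal s φ (suc l) t = begin
  ι (suc s ℕ.* falling s l) * φ t
    ≡⟨ cong (_* φ t) (trans (ι-* (suc s) (falling s l)) (cong (_* ι (falling s l)) (ι-suc s))) ⟩
  (1ℚ + ι s) * ι (falling s l) * φ t
    ≡⟨ solve 4 (λ a b c d → (con 1ℚ :+ a) :* c :* d := (a :- b) :* c :* d :+ (con 1ℚ :+ b) :* (c :* d)) refl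
        (ι s) (ι l) (ι (falling s l)) (φ t) ⟩
  (ι s - ι l) * ι (falling s l) * φ t + (1ℚ + ι l) * (ι (falling s l) * φ t)
    ≡⟨ cong₂ (λ x y → x * φ t + y * (ι (falling s l) * φ t)) (falling-suc s l) (ι-suc l) ⟨
  ι (falling s (suc l)) * φ t + ι (suc l) * (ι (falling s l) * φ t) ∎
  where open ≡-Reasoning; open +-*-Solver

-- A Leibniz rule: the marked part is one of the `x` parts set aside or one of the other `l`. At
-- `x = 0` the truncated predecessor does no harm, since its coefficient `ι x` is 0.
∇-+ : ∀ Φ x l t → ∇ Φ (x ℕ.+ l) t ≡ ι x * Φ (ℕ.pred x ℕ.+ l) t + ∇ (λ l → Φ (x ℕ.+ l)) l t
∇-+ Φ zero    l       t = sym (trans (cong (_+ ∇ Φ l t) (ℚP.*-zeroˡ (Φ l t))) (ℚP.+-identityˡ (∇ Φ l t)))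
∇-+ Φ (suc x) zero    t = trans (cong (λ k → ι (suc k) * Φ (x ℕ.+ 0) t) (ℕP.+-identityʳ x)) (sym (ℚP.+-identityʳ _))
∇-+ Φ (suc x) (suc l) t = begin
  ι (suc x ℕ.+ suc l) * Φ (x ℕ.+ suc l) t
    ≡⟨ cong (_* Φ (x ℕ.+ suc l) t) (ι-+ (suc x) (suc l)) ⟩
  (ι (suc x) + ι (suc l)) * Φ (x ℕ.+ suc l) t
    ≡⟨ ℚP.*-distribʳ-+ (Φ (x ℕ.+ suc l) t) (ι (suc x)) (ι (suc l)) ⟩
  ι (suc x) * Φ (x ℕ.+ suc l) t + ι (suc l) * Φ (x ℕ.+ suc l) t
    ≡⟨ cong (λ k → ι (suc x) * Φ (x ℕ.+ suc l) t + ι (suc l) * Φ k t) (ℕP.+-suc x l) ⟩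
  ι (suc x) * Φ (x ℕ.+ suc l) t + ι (suc l) * Φ (suc x ℕ.+ l) t ∎
  where open ≡-Reasoning

-- Weighted sums over partitions.

module PartitionSums (g : ℕ → ℚ) where

  -- A coefficient of the exponential of `g k`: the `x` parts of size `k` are interchangeable, hence
  -- the reciprocal factorial.
  w : ℕ → ℕ → ℚ
  w k x = pow (g k) x * 1/! x

  w-suc : ∀ k x → w k (suc x) * ι (suc x) ≡ g k * w k x
  w-suc k x = trans (solve 4 (λ a b c d → a :* b :* c :* d := a :* (b :* (d :* c))) refl (g k) (pow (g k) x) (1/! (suc x)) (ι (suc x)))
    (cong (λ z → g k * (pow (g k) x * z)) (suc-1/! x))
    where open +-*-Solver

  W : ∀ {L} → ℕ → Vec ℕ L → ℚ
  W a []      = 1ℚ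
  W a (x ∷ m) = w a x * W (suc a) m

  size : ∀ {L} → ℕ → Vec ℕ L → ℕ
  size a []      = 0
  size a (x ∷ m) = a ℕ.* x ℕ.+ size (suc a) m

  module _ (b : ℕ) where

    -- The part sizes are `a`, ..., `a + L - 1`, each with multiplicity at most `b`. With a test
    -- function in place of the condition on the size, removing a part is a shift of the arguments
    -- of `Φ`.
    E : ∀ L → ℕ → (ℕ → ℕ → ℚ) → ℚ
    E L a Φ = Sum (vecs b L) (λ m → W a m * Φ (numParts m) (size a m))

    E-cong : ∀ L a {Φ Ψ : ℕ → ℕ → ℚ} → (∀ l t → Φ l t ≡ Ψ l t) → E L a Φ ≡ E L a Ψ
    E-cong L a eq = Sum-cong (vecs b L) (λ m → cong (W a m *_) (eq (numParts m) (size a m)))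

    E-+ : ∀ L a (Φ Ψ : ℕ → ℕ → ℚ) → E L a (λ l t → Φ l t + Ψ l t) ≡ E L a Φ + E L a Ψ
    E-+ L a Φ Ψ = trans (Sum-cong (vecs b L) (λ m → ℚP.*-distribˡ-+ (W a m) _ _)) (Sum-+ (vecs b L) _ _)

    E-*ˡ : ∀ L a c (Φ : ℕ → ℕ → ℚ) → E L a (λ l t → c * Φ l t) ≡ c * E L a Φ
    E-*ˡ L a c Φ = trans (Sum-cong (vecs b L) (λ m →
      solve 3 (λ x y z → x :* (y :* z) := y :* (x :* z)) refl (W a m) c (Φ (numParts m) (size a m)))) (Sum-*ˡ (vecs b L) c _)
      where open +-*-Solver

    E-zero : ∀ L a {Φ : ℕ → ℕ → ℚ} → (∀ l t → Φ l t ≡ 0ℚ) → E L a Φ ≡ 0ℚ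
    E-zero L a eq = Sum-zero (vecs b L) (λ m → trans (cong (W a m *_) (eq _ _)) (ℚP.*-zeroʳ (W a m)))

    E-suc : ∀ L a Φ → E (suc L) a Φ ≡ Sum (upTo (suc b)) (λ x → w a x * E L (suc a) (λ l t → Φ (x ℕ.+ l) (a ℕ.* x ℕ.+ t)))
    E-suc L a Φ = trans (Sum-vecs b L (λ m → W a m * Φ (numParts m) (size a m))) (Sum-cong (upTo (suc b)) (λ x →
      trans (Sum-cong (vecs b L) (λ m → ℚP.*-assoc (w a x) (W (suc a) m) (Φ (x ℕ.+ numParts m) (a ℕ.* x ℕ.+ size (suc a) m))))
        (Sum-*ˡ (vecs b L) (w a x) (λ m → W (suc a) m * Φ (x ℕ.+ numParts m) (a ℕ.* x ℕ.+ size (suc a) m)))))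

    -- ∇ marks one of the parts counted by numParts; removing a marked part k costs the factor g k.
    E-∇ : ∀ L a Φ → (∀ l t → b ℕ.< t → Φ l t ≡ 0ℚ) →
      E L (suc a) (∇ Φ) ≡ sumFrom (suc a) L (λ k → g k * E L (suc a) (λ l t → Φ l (k ℕ.+ t)))
    E-∇ zero    a Φ bound = trans (ℚP.+-identityʳ _) (ℚP.*-zeroʳ 1ℚ)
    E-∇ (suc L) a′ Φ bound = begin
      E (suc L) a (∇ Φ)
        ≡⟨ E-suc L a (∇ Φ) ⟩
      Sum (upTo (suc b)) (λ x → w a x * E L (suc a) (λ l t → ∇ Φ (x ℕ.+ l) (a ℕ.* x ℕ.+ t)))
        ≡⟨ Sum-cong (upTo (suc b)) split ⟩
      Sum (upTo (suc b)) (λ x → head x + tail x)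
        ≡⟨ Sum-+ (upTo (suc b)) head tail ⟩
      Sum (upTo (suc b)) head + Sum (upTo (suc b)) tail
        ≡⟨ cong₂ _+_ heads tails ⟩
      g a * E (suc L) a (λ l t → Φ l (a ℕ.+ t)) + sumFrom (suc a) L (λ k → g k * E (suc L) a (λ l t → Φ l (k ℕ.+ t))) ∎
      where
      open ≡-Reasoning
      a = suc a′
      Φ∙ : ℕ → ℕ → ℕ → ℚ
      Φ∙ x l t = Φ (x ℕ.+ l) (a ℕ.* x ℕ.+ t)
      Φ⁻ : ℕ → ℕ → ℕ → ℚ
      Φ⁻ x l t = Φ (ℕ.pred x ℕ.+ l) (a ℕ.* x ℕ.+ t)
      -- The marked part has the smallest available size `a` in `head` and a larger size in `tail`.
      head tail : ℕ → ℚ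
      head x = w a x * ι x * E L (suc a) (Φ⁻ x)
      tail x = sumFrom (suc a) L (λ k → g k * (w a x * E L (suc a) (λ l t → Φ∙ x l (k ℕ.+ t))))
      split : ∀ x → w a x * E L (suc a) (λ l t → ∇ Φ (x ℕ.+ l) (a ℕ.* x ℕ.+ t)) ≡ head x + tail x
      split x = begin
        w a x * E L (suc a) (λ l t → ∇ Φ (x ℕ.+ l) (a ℕ.* x ℕ.+ t))
          ≡⟨ cong (w a x *_) (trans (E-cong L (suc a) (λ l t → trans (∇-+ Φ x l (a ℕ.* x ℕ.+ t)) (cong (ι x * Φ⁻ x l t +_) (∇-∙ l t))))
               (trans (E-+ L (suc a) (λ l t → ι x * Φ⁻ x l t) (∇ (Φ∙ x))) (cong₂ _+_ (E-*ˡ L (suc a) (ι x) (Φ⁻ x))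
                 (E-∇ L (suc a′) (Φ∙ x) (λ l t b<t → bound (x ℕ.+ l) (a ℕ.* x ℕ.+ t) (ℕP.<-≤-trans b<t (ℕP.m≤n+m t (a ℕ.* x)))))))) ⟩
        w a x * (ι x * E L (suc a) (Φ⁻ x)
          + sumFrom (suc a) L (λ k → g k * E L (suc a) (λ l t → Φ∙ x l (k ℕ.+ t))))
          ≡⟨ trans (ℚP.*-distribˡ-+ (w a x) _ _) (cong₂ _+_ (sym (ℚP.*-assoc (w a x) (ι x) _))
               (trans (sym (sumFrom-*ˡ (suc a) L (w a x) _)) (sumFrom-cong (suc a) L (λ k →
                 solve 3 (λ x y z → x :* (y :* z) := y :* (x :* z)) refl (w a x) (g k) (E L (suc a) (λ l t → Φ∙ x l (k ℕ.+ t))))))) ⟩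
        head x + tail x ∎
        where
        open +-*-Solver
        ∇-∙ : ∀ l t → ∇ (λ l → Φ (x ℕ.+ l)) l (a ℕ.* x ℕ.+ t) ≡ ∇ (Φ∙ x) l t
        ∇-∙ zero    t = refl
        ∇-∙ (suc l) t = refl
      heads : Sum (upTo (suc b)) head ≡ g a * E (suc L) a (λ l t → Φ l (a ℕ.+ t))
      heads = begin
        Sum (upTo (suc b)) head
          ≡⟨ trans (Sum-upTo-suc b head) (trans (cong (_+ Sum (upTo b) (head ∘ suc)) (trans (cong (_* E L (suc a) (Φ⁻ 0)) (ℚP.*-zeroʳ (w a 0))) (ℚP.*-zeroˡ (E L (suc a) (Φ⁻ 0))))) (ℚP.+-identityˡ _)) ⟩
        Sum (upTo b) (head ∘ suc)
          ≡⟨ Sum-cong (upTo b) shift ⟩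
        Sum (upTo b) (λ y → g a * next y)
          ≡⟨ trans (cong (Sum (upTo b) (λ y → g a * next y) +_) overflow) (ℚP.+-identityʳ _) ⟨
        Sum (upTo b) (λ y → g a * next y) + g a * next b
          ≡⟨ Sum-upTo-last b (λ y → g a * next y) ⟨
        Sum (upTo (suc b)) (λ y → g a * next y)
          ≡⟨ Sum-*ˡ (upTo (suc b)) (g a) next ⟩
        g a * Sum (upTo (suc b)) next
          ≡⟨ cong (g a *_) (E-suc L a (λ l t → Φ l (a ℕ.+ t))) ⟨
        g a * E (suc L) a (λ l t → Φ l (a ℕ.+ t)) ∎
        where
        next : ℕ → ℚ
        next y = w a y * E L (suc a) (λ l t → Φ (y ℕ.+ l) (a ℕ.+ (a ℕ.* y ℕ.+ t)))
        shift : ∀ y → head (suc y) ≡ g a * next y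
        shift y = trans (cong₂ _*_ (w-suc a y) (E-cong L (suc a) (λ l t → cong (Φ (y ℕ.+ l))
            (trans (cong (ℕ._+ t) (ℕP.*-suc a y)) (ℕP.+-assoc a (a ℕ.* y) t)))))
          (ℚP.*-assoc (g a) (w a y) _)
        -- Restoring the removed part would raise the multiplicity `b` to `b + 1`, which the
        -- enumeration omits. The extra term is 0: `b + 1` parts of the positive size `a` exceed the
        -- size `b` beyond which `Φ` vanishes.
        overflow : g a * next b ≡ 0ℚ
        overflow = trans (cong (g a *_) (trans (cong (w a b *_) (E-zero L (suc a) (λ l t → bound (b ℕ.+ l) _
            (s≤s (ℕP.≤-trans (ℕP.≤-trans (ℕP.m≤m+n b (a′ ℕ.* b)) (ℕP.m≤m+n (a ℕ.* b) t)) (ℕP.m≤n+m (a ℕ.* b ℕ.+ t) a′))))))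
          (ℚP.*-zeroʳ (w a b)))) (ℚP.*-zeroʳ (g a))
      tails : Sum (upTo (suc b)) tail ≡ sumFrom (suc a) L (λ k → g k * E (suc L) a (λ l t → Φ l (k ℕ.+ t)))
      tails = trans (sumFrom-Sum (suc a) L (upTo (suc b)) (λ x k → g k * (w a x * E L (suc a) (λ l t → Φ∙ x l (k ℕ.+ t)))))
        (sumFrom-cong (suc a) L (λ k → trans (Sum-*ˡ (upTo (suc b)) (g k) _) (cong (g k *_) (trans
          (Sum-cong (upTo (suc b)) (λ x → cong (w a x *_) (E-cong L (suc a) (λ l t → cong (Φ (x ℕ.+ l)) (swap x k t)))))
          (sym (E-suc L a (λ l t → Φ l (k ℕ.+ t))))))))
        where
        swap : ∀ x k t → a ℕ.* x ℕ.+ (k ℕ.+ t) ≡ k ℕ.+ (a ℕ.* x ℕ.+ t)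
        swap x k t = trans (sym (ℕP.+-assoc (a ℕ.* x) k t)) (trans (cong (ℕ._+ t) (ℕP.+-comm (a ℕ.* x) k)) (ℕP.+-assoc k (a ℕ.* x) t))

    -- Only the zero multiplicity vector has no parts, and its weight is 1.
    E-empty : ∀ L a Φ → (∀ l t → Φ (suc l) t ≡ 0ℚ) → E L a Φ ≡ Φ 0 0
    E-empty zero    a Φ zeros = trans (ℚP.+-identityʳ _) (ℚP.*-identityˡ (Φ 0 0))
    E-empty (suc L) a Φ zeros = begin
      E (suc L) a Φ
        ≡⟨ trans (E-suc L a Φ) (Sum-upTo-suc b (λ x → w a x * E L (suc a) (Φ∙ x))) ⟩
      w a 0 * E L (suc a) (Φ∙ 0) + Sum (upTo b) (λ x → w a (suc x) * E L (suc a) (Φ∙ (suc x)))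
        ≡⟨ cong₂ _+_ (trans (ℚP.*-identityˡ _) (E-empty L (suc a) (Φ∙ 0) (λ l t → zeros l (a ℕ.* 0 ℕ.+ t))))
             (Sum-zero (upTo b) (λ x → trans (cong (w a (suc x) *_) (E-zero L (suc a) {Φ∙ (suc x)} (λ l t → zeros (x ℕ.+ l) _))) (ℚP.*-zeroʳ (w a (suc x))))) ⟩
      Φ 0 (a ℕ.* 0 ℕ.+ 0) + 0ℚ
        ≡⟨ trans (ℚP.+-identityʳ _) (cong (Φ 0) (trans (ℕP.+-identityʳ (a ℕ.* 0)) (ℕP.*-zeroʳ a))) ⟩
      Φ 0 0 ∎
      where
      open ≡-Reasoning
      Φ∙ : ℕ → ℕ → ℕ → ℚ
      Φ∙ x l t = Φ (x ℕ.+ l) (a ℕ.* x ℕ.+ t)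

-- Evaluation of the partition formula.

pow-* : ∀ x y n → pow (x * y) n ≡ pow x n * pow y n
pow-* x y zero    = refl
pow-* x y (suc n) = trans (cong (x * y *_) (pow-* x y n))
  (solve 4 (λ a b c d → a :* b :* (c :* d) := a :* c :* (b :* d)) refl x y (pow x n) (pow y n))
  where open +-*-Solver

prodFrom-const : ∀ a n y → prodFrom a n (λ _ → y) ≡ pow y n
prodFrom-const a zero    y = refl
prodFrom-const a (suc n) y = cong (y *_) (prodFrom-const (suc a) n y)

pow-prodFrom : ∀ a n f x → prodFrom a n (λ j → pow (f j) x) ≡ pow (prodFrom a n f) x
pow-prodFrom a zero    f zero    = refl
pow-prodFrom a zero    f (suc x) = trans (pow-prodFrom a zero f x) (sym (ℚP.*-identityˡ _))
pow-prodFrom a (suc n) f x       = trans (cong (pow (f a) x *_) (pow-prodFrom (suc a) n f x)) (sym (pow-* (f a) (prodFrom (suc a) n f) x))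

pow-inverse : ∀ {x y} → x * y ≡ 1ℚ → ∀ n → pow x n * pow y n ≡ 1ℚ
pow-inverse {x} {y} xy≡1 n = trans (sym (pow-* x y n)) (trans (cong (λ z → pow z n) xy≡1) (pow-1 n))
  where
  pow-1 : ∀ n → pow 1ℚ n ≡ 1ℚ
  pow-1 zero    = refl
  pow-1 (suc n) = trans (ℚP.*-identityˡ _) (pow-1 n)

ι-^ : ∀ a n → ι (a ℕ.^ n) ≡ pow (ι a) n
ι-^ a zero    = refl
ι-^ a (suc n) = trans (ι-* a (a ℕ.^ n)) (cong (ι a *_) (ι-^ a n))

ι-^2 : ∀ a n → ι (a ℕ.^ (2 ℕ.* n)) ≡ pow (ι a * ι a) n
ι-^2 a n = trans (cong ι (sym (ℕP.^-*-assoc a 2 n))) (trans (ι-^ (a ℕ.^ 2) n)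
  (cong (λ z → pow z n) (trans (ι-^ a 2) (cong (ι a *_) (ℚP.*-identityʳ (ι a))))))

-- Each factor taken off raises `a` and lowers `s` while `suc a + s` stays fixed. Once `s` is
-- exhausted the next factor is 0, in agreement with `falling`.
falling-prodFrom : ∀ a s l → prodFrom (suc a) l (λ i → ι (suc a ℕ.+ s) - ι i) ≡ ι (falling s l)
falling-prodFrom a s       zero    = refl
falling-prodFrom a zero    (suc l) = trans
  (cong (_* prodFrom (suc (suc a)) l (λ i → ι (suc a ℕ.+ 0) - ι i))
    (trans (cong (λ k → ι k - ι (suc a)) (ℕP.+-identityʳ (suc a))) (ℚP.+-inverseʳ (ι (suc a)))))
  (ℚP.*-zeroˡ (prodFrom (suc (suc a)) l (λ i → ι (suc a ℕ.+ 0) - ι i)))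
falling-prodFrom a (suc s) (suc l) = trans (cong₂ _*_ first rest) (sym (ι-* (suc s) (falling s l)))
  where
  open +-*-Solver
  first : ι (suc a ℕ.+ suc s) - ι (suc a) ≡ ι (suc s)
  first = trans (cong (_- ι (suc a)) (ι-+ (suc a) (suc s)))
    (solve 2 (λ x y → (x :+ y) :- x := y) refl (ι (suc a)) (ι (suc s)))
  rest : prodFrom (suc (suc a)) l (λ i → ι (suc a ℕ.+ suc s) - ι i) ≡ ι (falling s l)
  rest = trans (prodFrom-cong (suc (suc a)) l (λ i → cong (λ k → ι k - ι i) (ℕP.+-suc (suc a) s))) (falling-prodFrom (suc a) s l)

module RightHandSide (q : ℕ) where

  open Colourings q
  open PartitionSums g

  -- Induction on the number of colours: the difference in `s` marks a part, and removing it
  -- reproduces the Cauchy product with `g`. The bounds `b` and `L` stay fixed while `n` drops to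
  -- `j`, hence inequalities rather than `b = L = n`.
  E-normalised : ∀ b L s n → n ≤ b → n ≤ L → E b L 1 (λ l t → ι (falling s l) * 𝟙 (t ℕ.≟ n)) ≡ normalised s n
  E-normalised b L zero n n≤b n≤L = trans
    (E-empty b L 1 (λ l t → ι (falling 0 l) * 𝟙 (t ℕ.≟ n)) (λ l t → ℚP.*-zeroˡ (𝟙 (t ℕ.≟ n)))) (trans (ℚP.*-identityˡ (𝟙 (0 ℕ.≟ n))) (δ₀ n))
    where
    δ₀ : ∀ n → 𝟙 (0 ℕ.≟ n) ≡ normalised 0 n
    δ₀ zero    = refl
    δ₀ (suc n) = sym (normalised-0-suc n)
  E-normalised b L (suc s) n n≤b n≤L = begin
    E b L 1 (λ l t → ι (falling (suc s) l) * 𝟙 (t ℕ.≟ n))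
      ≡⟨ trans (E-cong b L 1 (falling-pascal s (λ t → 𝟙 (t ℕ.≟ n)))) (E-+ b L 1 (Φ 0) (∇ (Φ 0))) ⟩
    E b L 1 (Φ 0) + E b L 1 (∇ (Φ 0))
      -- `g 0` evaluates to 1, so the unmarked sum is the term `k = 0` missing from the sum over
      -- removed parts.
      ≡⟨ cong₂ _+_ (sym (ℚP.*-identityˡ (E b L 1 (Φ 0)))) (E-∇ b L 0 (Φ 0) (λ l t b<t → trans
           (cong (ι (falling s l) *_) (𝟙-no (t ℕ.≟ n) (λ t≡n → ℕP.<⇒≱ b<t (subst (_≤ b) (sym t≡n) n≤b)))) (ℚP.*-zeroʳ (ι (falling s l))))) ⟩
    sumFrom 0 (suc L) (λ k → g k * E b L 1 (Φ k))
      ≡⟨ convolution-sumFrom n L _ (λ i j → g i * normalised s j) n≤L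
           (λ i j p → cong (g i *_) (trans
             (E-cong b L 1 (λ l t → cong (ι (falling s l) *_) (𝟙-⇔ (i ℕ.+ t ℕ.≟ n) (t ℕ.≟ j)
               (λ eq → ℕP.+-cancelˡ-≡ i t j (trans eq (sym p))) (λ eq → trans (cong (i ℕ.+_) eq) p))))
             (E-normalised b L s j (ℕP.≤-trans (j≤n i j p) n≤b) (ℕP.≤-trans (j≤n i j p) n≤L))))
           (λ i n<i → trans (cong (g i *_) (E-zero b L 1 (λ l t → trans
             (cong (ι (falling s l) *_) (𝟙-no (i ℕ.+ t ℕ.≟ n) (λ eq → ℕP.<⇒≱ n<i (subst (i ≤_) eq (ℕP.m≤m+n i t)))))
             (ℚP.*-zeroʳ (ι (falling s l)))))) (ℚP.*-zeroʳ (g i))) ⟩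
    convolution n (λ i j → g i * normalised s j)
      ≡⟨ normalised-suc s n ⟨
    normalised (suc s) n ∎
    where
    open ≡-Reasoning
    Φ : ℕ → ℕ → ℕ → ℚ
    Φ k l t = ι (falling s l) * 𝟙 (k ℕ.+ t ℕ.≟ n)
    j≤n : ∀ i j → i ℕ.+ j ≡ n → j ≤ n
    j≤n i j p = subst (j ≤_) p (ℕP.m≤n+m j i)

  size-weight : ∀ {L} a (m : Vec ℕ L) → Vec.sum (tabulate (λ i → (a ℕ.+ toℕ i) ℕ.* lookup m i)) ≡ size a m
  size-weight a []      = refl
  size-weight a (x ∷ m) = cong₂ ℕ._+_ (cong (ℕ._* x) (ℕP.+-identityʳ a))
    (trans (cong Vec.sum (VecP.tabulate-cong (λ i → cong (ℕ._* lookup m i) (ℕP.+-suc a (toℕ i))))) (size-weight (suc a) m))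

  -- The `2 * x` factors `k !` of the denominator are shared among the `x` copies of `inj k k`,
  -- giving a power of `g k`; what remains is `1/! x`.
  part-factor : ∀ k x → prodFrom 0 k (λ j → prodFrom 0 x (λ _ → Q k - Q j)) ÷' ι ((k !) ℕ.^ (2 ℕ.* x) ℕ.* (x !)) ≡ w k x
  part-factor k x = begin
    prodFrom 0 k (λ j → prodFrom 0 x (λ _ → Q k - Q j)) ÷' D
      ≡⟨ ÷'-* _ D ⟩
    prodFrom 0 k (λ j → prodFrom 0 x (λ _ → Q k - Q j)) * (1ℚ ÷' D)
      ≡⟨ cong₂ _*_ (trans (prodFrom-cong 0 k (λ j → prodFrom-const 0 x (Q k - Q j))) (pow-prodFrom 0 k (λ j → Q k - Q j) x))
           (÷'-unique D⁻¹ D≢0 DD⁻¹≡1) ⟩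
    pow (inj k k) x * (pow (1/! k * 1/! k) x * 1/! x)
      ≡⟨ solve 3 (λ a b c → a :* (b :* c) := b :* a :* c) refl (pow (inj k k) x) (pow (1/! k * 1/! k) x) (1/! x) ⟩
    pow (1/! k * 1/! k) x * pow (inj k k) x * 1/! x
      ≡⟨ cong (_* 1/! x) (pow-* (1/! k * 1/! k) (inj k k) x) ⟨
    w k x ∎
    where
    open ≡-Reasoning
    open +-*-Solver
    D D⁻¹ : ℚ
    D   = ι ((k !) ℕ.^ (2 ℕ.* x) ℕ.* (x !))
    D⁻¹ = pow (1/! k * 1/! k) x * 1/! x
    D≢0 : D ≢ 0ℚ
    D≢0 = ι≢0 _ (ℕ.≢-nonZero⁻¹ _ {{ℕP.m*n≢0 _ _ {{ℕP.m^n≢0 (k !) (2 ℕ.* x) {{k ℕP.!≢0}}}} {{x ℕP.!≢0}}}})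
    DD⁻¹≡1 : D * D⁻¹ ≡ 1ℚ
    DD⁻¹≡1 = begin
      D * D⁻¹
        ≡⟨ cong (_* D⁻¹) (trans (ι-* ((k !) ℕ.^ (2 ℕ.* x)) (x !)) (cong (_* ι (x !)) (ι-^2 (k !) x))) ⟩
      pow (ι (k !) * ι (k !)) x * ι (x !) * (pow (1/! k * 1/! k) x * 1/! x)
        ≡⟨ solve 4 (λ a b c d → a :* b :* (c :* d) := a :* c :* (b :* d)) refl (pow (ι (k !) * ι (k !)) x) (ι (x !)) (pow (1/! k * 1/! k) x) (1/! x) ⟩
      pow (ι (k !) * ι (k !)) x * pow (1/! k * 1/! k) x * (ι (x !) * 1/! x)
        ≡⟨ cong₂ _*_ (pow-inverse (trans (solve 2 (λ a b → a :* a :* (b :* b) := (a :* b) :* (a :* b)) refl (ι (k !)) (1/! k))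
             (cong₂ _*_ (!-1/! k) (!-1/! k))) x) (!-1/! x) ⟩
      1ℚ * 1ℚ ∎

  prodFrom-W : ∀ {L} a (m : Vec ℕ L) f → (∀ i → f (a ℕ.+ i) ≡ w (a ℕ.+ i) (mult m (suc i))) → prodFrom a L f ≡ W a m
  prodFrom-W a []      f eq = refl
  prodFrom-W a (x ∷ m) f eq = cong₂ _*_
    (subst (λ k → f k ≡ w k x) (ℕP.+-identityʳ a) (eq 0))
    (prodFrom-W (suc a) m f (λ i → subst (λ k → f k ≡ w k (mult m (suc i))) (ℕP.+-suc a i) (eq (suc i))))

-- The prefactor `(n !) ^ 2` cancels the normalisation, leaving the number of fixed triples over the
-- order of the acting group.
rhs-total : ∀ s n → rhs (suc s) n ≡ (1ℚ ÷' ι (s ℕ.^ (2 ℕ.* n))) * Colourings.total (suc s) s n n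
rhs-total s n = begin
  (ι ((n !) ℕ.^ 2) ÷' P) * sumList (List.map (term q) (partitions n))
    ≡⟨ cong₂ _*_ (trans (÷'-* (ι ((n !) ℕ.^ 2)) P) (cong (_* (1ℚ ÷' P)) (trans (ι-^ (n !) 2) (cong (ι (n !) *_) (ℚP.*-identityʳ (ι (n !)))))))
         (trans (trans (sumList-map (term q) (partitions n)) (Sum-filter (λ m → weight m ℕ.≟ n) (vecs n n) (term q)))
           (trans (Sum-cong (vecs n n) term-W) (E-normalised n n s n ℕP.≤-refl ℕP.≤-refl))) ⟩
  ι (n !) * ι (n !) * (1ℚ ÷' P) * (1/! n * 1/! n * total s n n)
    ≡⟨ solve 4 (λ f i r t → f :* f :* i :* (r :* r :* t) := f :* r :* (f :* r) :* (i :* t)) refl (ι (n !)) (1ℚ ÷' P) (1/! n) (total s n n) ⟩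
  ι (n !) * 1/! n * (ι (n !) * 1/! n) * ((1ℚ ÷' P) * total s n n)
    ≡⟨ cong (λ z → z * z * ((1ℚ ÷' P) * total s n n)) (!-1/! n) ⟩
  1ℚ * 1ℚ * ((1ℚ ÷' P) * total s n n)
    ≡⟨ ℚP.*-identityˡ _ ⟩
  (1ℚ ÷' P) * total s n n ∎
  where
  open ≡-Reasoning
  open +-*-Solver
  q = suc s
  open Colourings q
  open PartitionSums g
  open RightHandSide q
  P : ℚ
  P = ι (s ℕ.^ (2 ℕ.* n))
  term-W : ∀ m → 𝟙 (weight m ℕ.≟ n) * term q m ≡ W 1 m * (ι (falling s (numParts m)) * 𝟙 (size 1 m ℕ.≟ n))
  term-W m = begin
    𝟙 (weight m ℕ.≟ n) * term q m
      ≡⟨ cong₂ (λ k x → 𝟙 (k ℕ.≟ n) * x) (size-weight 1 m)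
           (cong₂ _*_ (falling-prodFrom 0 s (numParts m)) (prodFrom-W 1 m _ (λ i → part-factor (suc i) (mult m (suc i))))) ⟩
    𝟙 (size 1 m ℕ.≟ n) * (ι (falling s (numParts m)) * W 1 m)
      ≡⟨ solve 3 (λ a b c → a :* (b :* c) := c :* (b :* a)) refl (𝟙 (size 1 m ℕ.≟ n)) (ι (falling s (numParts m))) (W 1 m) ⟩
    W 1 m * (ι (falling s (numParts m)) * 𝟙 (size 1 m ℕ.≟ n)) ∎

-- Linear algebra over a field with underlying set `Fin q`.

-- With propositional equality on `Fin q`, rows and matrices are `Finite` types, so independence and
-- membership in a span are decidable by search.
record FieldOnFin (q : ℕ) : Set where
  infixl 6 _⊕_
  infixl 7 _⊗_
  infix  8 ⊖_
  field
    _⊕_ _⊗_ : Fin q → Fin q → Fin q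
    ⊖_      : Fin q → Fin q
    0# 1#   : Fin q
    isCommutativeRing : IsCommutativeRing _≡_ _⊕_ _⊗_ ⊖_ 0# 1#
    0≢1     : 0# ≢ 1#
    inverse : ∀ x → x ≢ 0# → ∃ λ y → x ⊗ y ≡ 1#

module LinearAlgebra {q : ℕ} (𝔽 : FieldOnFin q) where

  infixl 6 _⊞_
  infixl 7 _⊙_ _⊛_
  infix  4 _≟ᵣ_

  open FieldOnFin 𝔽

  private
    K = Fin q

    commutativeRing : CommutativeRing _ _
    commutativeRing = record { isCommutativeRing = isCommutativeRing }

    module K where
      open CommutativeRing commutativeRing public
      open RingProperties ring public

    module Solver = NaturalCoefficients (CommutativeRing.commutativeSemiring commutativeRing)

  Row : ℕ → Set
  Row n = Vec K n

  Rows : ℕ → ℕ → Set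
  Rows r n = Vec (Row n) r

  𝕂 = fins q

  rows : ∀ n → Finite (Row n)
  rows = vecs-finite 𝕂

  matrices : ∀ r n → Finite (Rows r n)
  matrices r n = vecs-finite (rows n) r

  0ᵥ : ∀ {n} → Row n
  0ᵥ {n} = Vec.replicate n 0#

  _⊙_ : ∀ {n} → K → Row n → Row n
  a ⊙ v = Vec.map (a ⊗_) v

  _⊞_ : ∀ {n} → Row n → Row n → Row n
  _⊞_ = Vec.zipWith _⊕_

  _⊛_ : ∀ {r n} → Row r → Rows r n → Row n
  []      ⊛ []      = 0ᵥ
  (x ∷ v) ⊛ (w ∷ A) = (x ⊙ w) ⊞ (v ⊛ A)

  ⊛-⊙ : ∀ {r n} a v (A : Rows r n) → (a ⊙ v) ⊛ A ≡ a ⊙ (v ⊛ A)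
  ⊛-⊙ a []      []      = sym (⊙-0 a _)
    where
    ⊙-0 : ∀ a n → a ⊙ 0ᵥ {n} ≡ 0ᵥ
    ⊙-0 a zero    = refl
    ⊙-0 a (suc n) = cong₂ _∷_ (K.zeroʳ a) (⊙-0 a n)
  ⊛-⊙ a (x ∷ v) (w ∷ A) = trans (cong ((a ⊗ x) ⊙ w ⊞_) (⊛-⊙ a v A)) (lem w (v ⊛ A))
    where
    lem : ∀ {n} (w z : Row n) → (a ⊗ x) ⊙ w ⊞ a ⊙ z ≡ a ⊙ (x ⊙ w ⊞ z)
    lem []      []      = refl
    lem (y ∷ w) (z ∷ u) = cong₂ _∷_ (solve 4 (λ a x y z → a :* x :* y :+ a :* z := a :* (x :* y :+ z)) refl a x y z) (lem w u)
      where open Solver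

  ⊛-⊞ : ∀ {r n} u v (A : Rows r n) → (u ⊞ v) ⊛ A ≡ u ⊛ A ⊞ v ⊛ A
  ⊛-⊞ [] [] [] = sym (0-⊞-0 _)
    where
    0-⊞-0 : ∀ n → 0ᵥ {n} ⊞ 0ᵥ ≡ 0ᵥ
    0-⊞-0 zero    = refl
    0-⊞-0 (suc n) = cong₂ _∷_ (K.+-identityˡ 0#) (0-⊞-0 n)
  ⊛-⊞ (x ∷ u) (y ∷ v) (w ∷ A) = trans (cong ((x ⊕ y) ⊙ w ⊞_) (⊛-⊞ u v A)) (lem w (u ⊛ A) (v ⊛ A))
    where
    lem : ∀ {n} (w p r : Row n) → (x ⊕ y) ⊙ w ⊞ (p ⊞ r) ≡ (x ⊙ w ⊞ p) ⊞ (y ⊙ w ⊞ r)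
    lem []      []      []      = refl
    lem (t ∷ w) (a ∷ p) (b ∷ r) = cong₂ _∷_
      (solve 5 (λ x y t a b → (x :+ y) :* t :+ (a :+ b) := x :* t :+ a :+ (y :* t :+ b)) refl x y t a b) (lem w p r)
      where open Solver

  0-⊙-⊞ : ∀ {n} (w z : Row n) → 0# ⊙ w ⊞ z ≡ z
  0-⊙-⊞ []      []      = refl
  0-⊙-⊞ (x ∷ w) (y ∷ z) = cong₂ _∷_ (trans (cong (_⊕ y) (K.zeroˡ x)) (K.+-identityˡ y)) (0-⊙-⊞ w z)

  Independent : ∀ {r n} → Rows r n → Set
  Independent A = ∀ v → v ⊛ A ≡ 0ᵥ → v ≡ 0ᵥ

  Span : ∀ {r n} → Rows r n → Row n → Set
  Span A w = ∃ λ v → v ⊛ A ≡ w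

  _≟ᵣ_ : ∀ {n} (u v : Row n) → Dec (u ≡ v)
  _≟ᵣ_ {n} = Finite._≟_ (rows n)

  independent? : ∀ {r n} (A : Rows r n) → Dec (Independent A)
  independent? {r} A = ∀? (rows r) (λ v → (v ⊛ A ≟ᵣ 0ᵥ) →-dec (v ≟ᵣ 0ᵥ))

  span? : ∀ {r n} (A : Rows r n) w → Dec (Span A w)
  span? {r} A w = ∃? (rows r) (λ v → v ⊛ A ≟ᵣ w)

  ⊞-neg : ∀ {n} (w : Row n) → (⊖ 1#) ⊙ w ⊞ w ≡ 0ᵥ
  ⊞-neg []      = refl
  ⊞-neg (x ∷ w) = cong₂ _∷_ (trans (cong (_⊕ x) (K.-1*x≈-x x)) (K.-‿inverseˡ x)) (⊞-neg w)

  ⊞-neg-injective : ∀ {n} (u v : Row n) → (⊖ 1#) ⊙ u ⊞ v ≡ 0ᵥ → u ≡ v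
  ⊞-neg-injective []      []      _  = refl
  ⊞-neg-injective (x ∷ u) (y ∷ v) eq = cong₂ _∷_
    (sym (K.x∙y⁻¹≈ε⇒x≈y y x (trans (K.+-comm y (⊖ x)) (trans (cong (_⊕ y) (sym (K.-1*x≈-x x))) (VecP.∷-injectiveˡ eq)))))
    (⊞-neg-injective u v (VecP.∷-injectiveʳ eq))

  independent-injective : ∀ {r n} (A : Rows r n) → Independent A → ∀ {u v} → u ⊛ A ≡ v ⊛ A → u ≡ v
  independent-injective A ind {u} {v} eq = ⊞-neg-injective u v (ind _ (begin
    ((⊖ 1#) ⊙ u ⊞ v) ⊛ A           ≡⟨ ⊛-⊞ ((⊖ 1#) ⊙ u) v A ⟩
    ((⊖ 1#) ⊙ u) ⊛ A ⊞ v ⊛ A       ≡⟨ cong (_⊞ v ⊛ A) (⊛-⊙ (⊖ 1#) u A) ⟩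
    (⊖ 1#) ⊙ (u ⊛ A) ⊞ v ⊛ A       ≡⟨ cong (λ z → (⊖ 1#) ⊙ z ⊞ v ⊛ A) eq ⟩
    (⊖ 1#) ⊙ (v ⊛ A) ⊞ v ⊛ A       ≡⟨ ⊞-neg (v ⊛ A) ⟩
    0ᵥ                             ∎))
    where open ≡-Reasoning

  -- A relation with a nonzero coefficient at `w` can be solved for `w`, which would put `w` in the
  -- span.
  independent-∷⁺ : ∀ {r n} (w : Row n) (A : Rows r n) → Independent A → ¬ Span A w → Independent (w ∷ A)
  independent-∷⁺ w A ind w∉ (x ∷ v) eq with x Fin.≟ 0#
  ... | yes refl = cong (0# ∷_) (ind v (trans (sym (0-⊙-⊞ w (v ⊛ A))) eq))
  ... | no x≢0   = contradiction ((⊖ y) ⊙ v , trans (⊛-⊙ (⊖ y) v A) (solve-row w (v ⊛ A) eq)) w∉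
    where
    y = proj₁ (inverse x x≢0)
    solve-row : ∀ {n} (w z : Row n) → x ⊙ w ⊞ z ≡ 0ᵥ → (⊖ y) ⊙ z ≡ w
    solve-row []      []      _  = refl
    solve-row (a ∷ w) (b ∷ z) eq = cong₂ _∷_ (begin
      (⊖ y) ⊗ b          ≡⟨ K.-‿distribˡ-* y b ⟨
      ⊖ (y ⊗ b)          ≡⟨ K.-‿distribʳ-* y b ⟩
      y ⊗ (⊖ b)          ≡⟨ cong (y ⊗_) (K.+-inverseˡ-unique (x ⊗ a) b (VecP.∷-injectiveˡ eq)) ⟨
      y ⊗ (x ⊗ a)        ≡⟨ K.*-assoc y x a ⟨
      y ⊗ x ⊗ a          ≡⟨ cong (_⊗ a) (trans (K.*-comm y x) (proj₂ (inverse x x≢0))) ⟩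
      1# ⊗ a             ≡⟨ K.*-identityˡ a ⟩
      a                  ∎) (solve-row w z (VecP.∷-injectiveʳ eq))
      where open ≡-Reasoning

  -- The coefficient 0 at `w` extends a relation among the rows of `A`. If `w` lies in the span, the
  -- coefficient -1 at `w` gives a relation, whence -1 = 0.
  independent-∷⁻ : ∀ {r n} (w : Row n) (A : Rows r n) → Independent (w ∷ A) → Independent A × ¬ Span A w
  independent-∷⁻ w A ind = (λ v eq → VecP.∷-injectiveʳ (ind (0# ∷ v) (trans (0-⊙-⊞ w (v ⊛ A)) eq)))
    , λ (v , vA≡w) → 0≢1 (begin
        0#           ≡⟨ K.-0#≈0# ⟨
        ⊖ 0#         ≡⟨ cong ⊖_ (VecP.∷-injectiveˡ (ind (⊖ 1# ∷ v) (trans (cong ((⊖ 1#) ⊙ w ⊞_) vA≡w) (⊞-neg w)))) ⟨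
        ⊖ (⊖ 1#)     ≡⟨ K.-‿involutive 1# ⟩
        1#           ∎)
    where open ≡-Reasoning

  -- Coordinates with respect to independent rows are unique, so at most one `v` contributes. Sums
  -- over a span thereby become sums over coordinate vectors.
  span-indicator : ∀ {r n} (A : Rows r n) → Independent A → ∀ w → 𝟙 (span? A w) ≡ Sum (elements (rows r)) (λ v → 𝟙 (w ≟ᵣ v ⊛ A))
  span-indicator {r} A ind w with span? A w
  ... | yes (u , refl) = sym (trans (Sum-cong (elements (rows r)) (λ v → 𝟙-⇔ (w ≟ᵣ v ⊛ A) (v ≟ᵣ u)
          (λ eq → independent-injective A ind (sym eq)) (λ eq → cong (_⊛ A) (sym eq)))) (once (rows r) u))
  ... | no w∉ = sym (Sum-zero (elements (rows r)) (λ v → 𝟙-no (w ≟ᵣ v ⊛ A) (λ eq → w∉ (v , sym eq))))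

  Sum-span : ∀ {r n} (A : Rows r n) → Independent A → (f : Row n → ℚ) →
    Sum (elements (rows n)) (λ w → 𝟙 (span? A w) * f w) ≡ Sum (elements (rows r)) (λ v → f (v ⊛ A))
  Sum-span {r} {n} A ind f = begin
    Sum (elements (rows n)) (λ w → 𝟙 (span? A w) * f w)
      ≡⟨ Sum-cong (elements (rows n)) (λ w → trans (cong (_* f w) (span-indicator A ind w)) (sym (Sum-*ʳ (elements (rows r)) (f w) _))) ⟩
    Sum (elements (rows n)) (λ w → Sum (elements (rows r)) (λ v → 𝟙 (w ≟ᵣ v ⊛ A) * f w))
      ≡⟨ Sum-swap (elements (rows n)) (elements (rows r)) _ ⟩
    Sum (elements (rows r)) (λ v → Sum (elements (rows n)) (λ w → 𝟙 (w ≟ᵣ v ⊛ A) * f w))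
      ≡⟨ Sum-cong (elements (rows r)) (λ v → sift (rows n) (v ⊛ A) f) ⟩
    Sum (elements (rows r)) (λ v → f (v ⊛ A)) ∎
    where open ≡-Reasoning

  -- `A` is square, so its coordinate vectors are as many as the rows of length `n`. They have
  -- distinct images, and the number of rows outside the span is therefore 0; no exchange argument
  -- is involved.
  independent-spans : ∀ {n} (A : Rows n n) → Independent A → ∀ w → Span A w
  independent-spans {n} A ind w = Dec.decidable-stable (span? A w)
    (Sum-𝟙≡0 (λ w → ¬? (span? A w)) (elements (rows n)) outside≡0 (complete (rows n) w))
    where
    open ≡-Reasoning
    xs = elements (rows n)
    outside≡0 : Sum xs (λ w → 𝟙 (¬? (span? A w))) ≡ 0ℚ
    outside≡0 = begin
      Sum xs (λ w → 𝟙 (¬? (span? A w)))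
        ≡⟨ Sum-cong xs (λ w → trans (𝟙-¬ (span? A w) (¬? (span? A w))) (cong (λ z → 1ℚ - z) (sym (ℚP.*-identityʳ (𝟙 (span? A w)))))) ⟩
      Sum xs (λ w → 1ℚ - 𝟙 (span? A w) * 1ℚ)
        ≡⟨ Sum-∸ xs (λ _ → 1ℚ) (λ w → 𝟙 (span? A w) * 1ℚ) ⟩
      Sum xs (λ _ → 1ℚ) - Sum xs (λ w → 𝟙 (span? A w) * 1ℚ)
        ≡⟨ cong (λ z → Sum xs (λ _ → 1ℚ) - z) (Sum-span A ind (λ _ → 1ℚ)) ⟩
      Sum xs (λ _ → 1ℚ) - Sum xs (λ _ → 1ℚ)
        ≡⟨ ℚP.+-inverseʳ (Sum xs (λ _ → 1ℚ)) ⟩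
      0ℚ ∎

  -- Independent rows with prescribed colours.

  module _ {s : ℕ} where

    Supported : ∀ {n} → Fin s → Vec (Fin s) n → Row n → Set
    Supported c []      []      = ⊤
    Supported c (y ∷ e) (x ∷ w) = (y ≢ c → x ≡ 0#) × Supported c e w

    supported? : ∀ {n} c (e : Vec (Fin s) n) w → Dec (Supported c e w)
    supported? c []      []      = yes _
    supported? c (y ∷ e) (x ∷ w) = ((¬? (y Fin.≟ c)) →-dec (x Fin.≟ 0#)) ×-dec supported? c e w

    Coloured : ∀ {r n} → Vec (Fin s) r → Vec (Fin s) n → Rows r n → Set
    Coloured []      e []      = ⊤
    Coloured (c ∷ d) e (w ∷ A) = Supported c e w × Coloured d e A

    coloured? : ∀ {r n} (d : Vec (Fin s) r) (e : Vec (Fin s) n) A → Dec (Coloured d e A)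
    coloured? []      e []      = yes _
    coloured? (c ∷ d) e (w ∷ A) = supported? c e w ×-dec coloured? d e A

    open Colourings q

    Sum-supported : ∀ {n} c (e : Vec (Fin s) n) → Sum (elements (rows n)) (λ w → 𝟙 (supported? c e w)) ≡ Q (count c e)
    Sum-supported {zero}  c [] = cong Q (sym (VecP.lookup-replicate c 0))
    Sum-supported {suc n} c (y ∷ e) with y Fin.≟ c
    ... | yes refl = begin
      Sum (elements (rows (suc n))) (λ w → 𝟙 (supported? c (c ∷ e) w))
        ≡⟨ Sum-words (elements 𝕂) n _ ⟩
      Sum (elements 𝕂) (λ x → Sum (elements (rows n)) (λ w → 𝟙 (supported? c (c ∷ e) (x ∷ w))))
        ≡⟨ Sum-cong (elements 𝕂) (λ x → trans
             (Sum-cong (elements (rows n)) (λ w → 𝟙-⇔ (supported? c (c ∷ e) (x ∷ w)) (supported? c e w) proj₂ (λ supp → contradiction refl , supp)))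
             (trans (Sum-supported c e) (sym (ℚP.*-identityˡ _)))) ⟩
      Sum (elements 𝕂) (λ x → 1ℚ * Q (count c e))
        ≡⟨ Sum-*ʳ (elements 𝕂) (Q (count c e)) (λ _ → 1ℚ) ⟩
      Sum (elements 𝕂) (λ _ → 1ℚ) * Q (count c e)
        ≡⟨ cong (_* Q (count c e)) (trans (Sum-1 (elements 𝕂)) (cong ι (ListP.length-tabulate {n = q} id))) ⟩
      ι q * Q (count c e)
        ≡⟨ ι-* q (q ℕ.^ count c e) ⟨
      Q (suc (count c e))
        ≡⟨ cong Q (lookup-bump-≡ c (counts e)) ⟨
      Q (count c (c ∷ e)) ∎
      where open ≡-Reasoning
    ... | no y≢c = begin
      Sum (elements (rows (suc n))) (λ w → 𝟙 (supported? c (y ∷ e) w))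
        ≡⟨ Sum-words (elements 𝕂) n _ ⟩
      Sum (elements 𝕂) (λ x → Sum (elements (rows n)) (λ w → 𝟙 (supported? c (y ∷ e) (x ∷ w))))
        ≡⟨ Sum-cong (elements 𝕂) (λ x → trans
             (Sum-cong (elements (rows n)) (λ w → 𝟙-× (x Fin.≟ 0#) (supported? c e w) (supported? c (y ∷ e) (x ∷ w))
               (λ (x≡0 , supp) → x≡0 y≢c , supp) (λ (x≡0 , supp) → (λ _ → x≡0) , supp)))
             (Sum-*ˡ (elements (rows n)) (𝟙 (x Fin.≟ 0#)) _)) ⟩
      Sum (elements 𝕂) (λ x → 𝟙 (x Fin.≟ 0#) * Sum (elements (rows n)) (λ w → 𝟙 (supported? c e w)))
        ≡⟨ sift 𝕂 0# _ ⟩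
      Sum (elements (rows n)) (λ w → 𝟙 (supported? c e w))
        ≡⟨ Sum-supported c e ⟩
      Q (count c e)
        ≡⟨ cong Q (lookup-bump-≢ y c (counts e) (y≢c ∘ sym)) ⟨
      Q (count c (y ∷ e)) ∎
      where open ≡-Reasoning

    supported-0 : ∀ {n} c (e : Vec (Fin s) n) → Supported c e 0ᵥ
    supported-0 c []      = _
    supported-0 c (y ∷ e) = (λ _ → refl) , supported-0 c e

    -- The alternative `x ≡ 0#` covers rows of other colours, whose support is arbitrary but whose
    -- coefficient is zero.
    supported-⊙-⊞ : ∀ {n} c (e : Vec (Fin s) n) x w z → (x ≡ 0# ⊎ Supported c e w) → Supported c e z → Supported c e (x ⊙ w ⊞ z)
    supported-⊙-⊞ c []      x []      []      _  _  = _
    supported-⊙-⊞ c (y ∷ e) x (a ∷ w) (b ∷ z) hw (b≡0 , hz) = entry hw , supported-⊙-⊞ c e x w z (Sum.map₂ proj₂ hw) hz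
      where
      entry : x ≡ 0# ⊎ Supported c (y ∷ e) (a ∷ w) → y ≢ c → x ⊗ a ⊕ b ≡ 0#
      entry (inj₁ x≡0)       y≢c = trans (cong₂ (λ t u → t ⊗ a ⊕ u) x≡0 (b≡0 y≢c)) (trans (K.+-identityʳ _) (K.zeroˡ a))
      entry (inj₂ (a≡0 , _)) y≢c = trans (cong₂ (λ t u → x ⊗ t ⊕ u) (a≡0 y≢c) (b≡0 y≢c)) (trans (K.+-identityʳ _) (K.zeroʳ x))

    supported-⊛ : ∀ {r n} c (d : Vec (Fin s) r) (e : Vec (Fin s) n) v A → Coloured d e A → Supported c d v → Supported c e (v ⊛ A)
    supported-⊛ c []      e []      []      _          _          = supported-0 c e
    supported-⊛ c (y ∷ d) e (x ∷ v) (w ∷ A) (hw , hA) (x≡0 , hv) =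
      supported-⊙-⊞ c e x w (v ⊛ A) hw′ (supported-⊛ c d e v A hA hv)
      where
      hw′ : x ≡ 0# ⊎ Supported c e w
      hw′ with y Fin.≟ c
      ... | yes refl = inj₂ hw
      ... | no y≢c   = inj₁ (x≡0 y≢c)

    -- The projection that kills the coordinates of colour `c`. Its kernel consists of the vectors
    -- supported in colour `c`, so support becomes an equation to which independence applies.
    erase : ∀ {n} → Fin s → Vec (Fin s) n → Row n → Row n
    erase c []      []      = []
    erase c (y ∷ d) (x ∷ v) with y Fin.≟ c
    ... | yes _ = 0# ∷ erase c d v
    ... | no _  = x ∷ erase c d v

    erase-erase : ∀ {n} c (e : Vec (Fin s) n) z → Supported c e z → erase c e z ≡ 0ᵥ
    erase-erase c []      []      _         = refl
    erase-erase c (y ∷ e) (x ∷ z) (x≡0 , hz) with y Fin.≟ c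
    ... | yes _  = cong (0# ∷_) (erase-erase c e z hz)
    ... | no y≢c = cong₂ _∷_ (x≡0 y≢c) (erase-erase c e z hz)

    erase-supported : ∀ {n} c (e : Vec (Fin s) n) z → erase c e z ≡ 0ᵥ → Supported c e z
    erase-supported c []      []      _  = _
    erase-supported c (y ∷ e) (x ∷ z) eq with y Fin.≟ c
    ... | yes y≡c = contradiction y≡c , erase-supported c e z (VecP.∷-injectiveʳ eq)
    ... | no _    = (λ _ → VecP.∷-injectiveˡ eq) , erase-supported c e z (VecP.∷-injectiveʳ eq)

    erase-same : ∀ {n} c (e : Vec (Fin s) n) x w z → Supported c e w → erase c e (x ⊙ w ⊞ z) ≡ 0# ⊙ w ⊞ erase c e z
    erase-same c []      x []      []      _        = refl
    erase-same c (y ∷ e) x (a ∷ w) (b ∷ z) (a≡0 , hw) with y Fin.≟ c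
    ... | yes _  = cong₂ _∷_ (sym (trans (K.+-identityʳ _) (K.zeroˡ a))) (erase-same c e x w z hw)
    ... | no y≢c = cong₂ _∷_ (cong (_⊕ b) (trans (trans (cong (x ⊗_) (a≡0 y≢c)) (K.zeroʳ x)) (sym (K.zeroˡ a)))) (erase-same c e x w z hw)

    erase-other : ∀ {n} c y (e : Vec (Fin s) n) x w z → y ≢ c → Supported y e w → erase c e (x ⊙ w ⊞ z) ≡ x ⊙ w ⊞ erase c e z
    erase-other c y []      x []      []      _   _         = refl
    erase-other c y (t ∷ e) x (a ∷ w) (b ∷ z) y≢c (a≡0 , hw) with t Fin.≟ c
    ... | yes refl = cong₂ _∷_ (sym (trans (K.+-identityʳ _) (trans (cong (x ⊗_) (a≡0 (y≢c ∘ sym))) (K.zeroʳ x)))) (erase-other c y e x w z y≢c hw)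
    ... | no _     = cong (_ ∷_) (erase-other c y e x w z y≢c hw)

    -- Up to permuting rows and columns, a coloured matrix is block diagonal.
    erase-⊛ : ∀ {r n} c (d : Vec (Fin s) r) (e : Vec (Fin s) n) v A → Coloured d e A → erase c d v ⊛ A ≡ erase c e (v ⊛ A)
    erase-⊛ c []      e []      []      _         = sym (erase-erase c e 0ᵥ (supported-0 c e))
    erase-⊛ c (y ∷ d) e (x ∷ v) (w ∷ A) (hw , hA) with y Fin.≟ c
    ... | yes refl = trans (cong (0# ⊙ w ⊞_) (erase-⊛ c d e v A hA)) (sym (erase-same c e x w (v ⊛ A) hw))
    ... | no y≢c   = trans (cong (x ⊙ w ⊞_) (erase-⊛ c d e v A hA)) (sym (erase-other c y e x w (v ⊛ A) y≢c hw))

    -- Erasing colour `c` from `v ⊛ A` gives zero, but it also gives the combination with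
    -- coefficients `erase c d v`; independence makes these coefficients vanish.
    supported-⊛⁻ : ∀ {r n} c (d : Vec (Fin s) r) (e : Vec (Fin s) n) v A → Independent A → Coloured d e A →
      Supported c e (v ⊛ A) → Supported c d v
    supported-⊛⁻ c d e v A ind hA hvA = erase-supported c d v
      (ind (erase c d v) (trans (erase-⊛ c d e v A hA) (erase-erase c e (v ⊛ A) hvA)))

    -- The rows already chosen in colour c span exactly the part of the row space supported in colour c.
    Sum-extensions : ∀ {r n} c (d : Vec (Fin s) r) (e : Vec (Fin s) n) A → Independent A → Coloured d e A →
      Sum (elements (rows n)) (λ w → 𝟙 (supported? c e w) * 𝟙 (¬? (span? A w))) ≡ Q (count c e) - Q (count c d)
    Sum-extensions {r} {n} c d e A ind hA = begin
      Sum ws (λ w → S w * 𝟙 (¬? (span? A w)))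
        ≡⟨ Sum-cong ws (λ w → trans (cong (S w *_) (𝟙-¬ (span? A w) (¬? (span? A w))))
             (solve 2 (λ a b → a :* (con 1ℚ :- b) := a :- b :* a) refl (S w) (𝟙 (span? A w)))) ⟩
      Sum ws (λ w → S w - 𝟙 (span? A w) * S w)
        ≡⟨ Sum-∸ ws S _ ⟩
      Sum ws S - Sum ws (λ w → 𝟙 (span? A w) * S w)
        ≡⟨ cong₂ _-_ (Sum-supported c e) (trans (Sum-span A ind S)
             (Sum-cong (elements (rows r)) (λ v → 𝟙-⇔ (supported? c e (v ⊛ A)) (supported? c d v)
               (supported-⊛⁻ c d e v A ind hA) (supported-⊛ c d e v A hA)))) ⟩
      Q (count c e) - Sum (elements (rows r)) (λ v → 𝟙 (supported? c d v))
        ≡⟨ cong (λ z → Q (count c e) - z) (Sum-supported c d) ⟩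
      Q (count c e) - Q (count c d) ∎
      where
      open ≡-Reasoning
      open +-*-Solver
      ws = elements (rows n)
      S : Row n → ℚ
      S w = 𝟙 (supported? c e w)

    Sum-coloured : ∀ {r n} (d : Vec (Fin s) r) (e : Vec (Fin s) n) →
      Sum (elements (matrices r n)) (λ A → 𝟙 (independent? A) * 𝟙 (coloured? d e A)) ≡ coloured d e
    Sum-coloured {zero} {n} [] e = trans (ℚP.+-identityʳ _) (trans (ℚP.*-identityʳ _) (𝟙-yes (independent? {n = n} []) (λ { [] _ → refl })))
    Sum-coloured {suc r} {n} (c ∷ d) e = begin
      Sum (elements (matrices (suc r) n)) (λ A → 𝟙 (independent? A) * 𝟙 (coloured? (c ∷ d) e A))
        ≡⟨ trans (Sum-words ws r _) (Sum-swap ws As _) ⟩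
      Sum As (λ A → Sum ws (λ w → 𝟙 (independent? (w ∷ A)) * 𝟙 (coloured? (c ∷ d) e (w ∷ A))))
        ≡⟨ Sum-cong As (λ A → trans (Sum-cong ws (λ w → separate A w)) (Sum-*ˡ ws (𝟙 (independent? A)) _)) ⟩
      Sum As (λ A → 𝟙 (independent? A) * Sum ws (λ w → 𝟙 (coloured? d e A) * X A w))
        -- The number of extensions is known only for independent coloured `A`; the two indicators
        -- supply exactly these hypotheses.
        ≡⟨ Sum-cong As (λ A → trans (𝟙-*-cong (independent? A) (λ ind → trans (Sum-*ˡ ws (𝟙 (coloured? d e A)) (X A))
             (𝟙-*-cong (coloured? d e A) (Sum-extensions c d e A ind)))) (sym (ℚP.*-assoc (𝟙 (independent? A)) _ _))) ⟩
      Sum As (λ A → 𝟙 (independent? A) * 𝟙 (coloured? d e A) * (Q (count c e) - Q (count c d)))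
        ≡⟨ Sum-*ʳ As (Q (count c e) - Q (count c d)) _ ⟩
      Sum As (λ A → 𝟙 (independent? A) * 𝟙 (coloured? d e A)) * (Q (count c e) - Q (count c d))
        ≡⟨ trans (cong (_* (Q (count c e) - Q (count c d))) (Sum-coloured d e)) (ℚP.*-comm (coloured d e) _) ⟩
      coloured (c ∷ d) e ∎
      where
      open ≡-Reasoning
      open +-*-Solver
      ws = elements (rows n)
      As = elements (matrices r n)
      X : Rows r n → Row n → ℚ
      X A w = 𝟙 (supported? c e w) * 𝟙 (¬? (span? A w))
      separate : ∀ A w → 𝟙 (independent? (w ∷ A)) * 𝟙 (coloured? (c ∷ d) e (w ∷ A))
        ≡ 𝟙 (independent? A) * (𝟙 (coloured? d e A) * X A w)
      separate A w = trans (cong₂ _*_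
          (𝟙-× (independent? A) (¬? (span? A w)) (independent? (w ∷ A)) (independent-∷⁻ w A) (λ (ind , w∉) → independent-∷⁺ w A ind w∉))
          (𝟙-× (supported? c e w) (coloured? d e A) (coloured? (c ∷ d) e (w ∷ A)) id id))
        (solve 4 (λ a b c d → a :* b :* (c :* d) := a :* (d :* (c :* b))) refl
          (𝟙 (independent? A)) (𝟙 (¬? (span? A w))) (𝟙 (supported? c e w)) (𝟙 (coloured? d e A)))

-- The action of pairs of diagonal matrices.

module DiagonalAction {s : ℕ} (𝔽 : FieldOnFin (suc s)) where

  open FieldOnFin 𝔽
  open LinearAlgebra 𝔽

  infixl 7 _∙_

  private
    commutativeRing : CommutativeRing _ _
    commutativeRing = record { isCommutativeRing = isCommutativeRing }

    module K = CommutativeRing commutativeRing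
    module Solver = NaturalCoefficients (CommutativeRing.commutativeSemiring commutativeRing)

  -- Skipping `0#` lists the nonzero scalars by `Fin s`, so one type serves for colours and for
  -- diagonal entries.
  unit : Fin s → Fin (suc s)
  unit = Fin.punchIn 0#

  unit≢0 : ∀ c → unit c ≢ 0#
  unit≢0 = FinP.punchInᵢ≢i 0#

  unit-injective : ∀ {a b} → unit a ≡ unit b → a ≡ b
  unit-injective {a} {b} = FinP.punchIn-injective 0# a b

  toUnit : ∀ {x} → x ≢ 0# → Fin s
  toUnit x≢0 = Fin.punchOut (x≢0 ∘ sym)

  unit-toUnit : ∀ {x} (x≢0 : x ≢ 0#) → unit (toUnit x≢0) ≡ x
  unit-toUnit x≢0 = FinP.punchIn-punchOut (x≢0 ∘ sym)

  ⊗-cancelˡ : ∀ a {x y} → a ≢ 0# → a ⊗ x ≡ a ⊗ y → x ≡ y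
  ⊗-cancelˡ a {x} {y} a≢0 eq = begin
    x               ≡⟨ K.*-identityˡ x ⟨
    1# ⊗ x          ≡⟨ cong (_⊗ x) ba≡1 ⟨
    b ⊗ a ⊗ x       ≡⟨ K.*-assoc b a x ⟩
    b ⊗ (a ⊗ x)     ≡⟨ cong (b ⊗_) eq ⟩
    b ⊗ (a ⊗ y)     ≡⟨ K.*-assoc b a y ⟨
    b ⊗ a ⊗ y       ≡⟨ cong (_⊗ y) ba≡1 ⟩
    1# ⊗ y          ≡⟨ K.*-identityˡ y ⟩
    y               ∎
    where
    open ≡-Reasoning
    b = proj₁ (inverse a a≢0)
    ba≡1 : b ⊗ a ≡ 1#
    ba≡1 = trans (K.*-comm b a) (proj₂ (inverse a a≢0))

  ⊗≢0 : ∀ {x y} → x ≢ 0# → y ≢ 0# → x ⊗ y ≢ 0#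
  ⊗≢0 {x} {y} x≢0 y≢0 xy≡0 = y≢0 (⊗-cancelˡ x x≢0 (trans xy≡0 (sym (K.zeroʳ x))))

  _∙_ : Fin s → Fin s → Fin s
  a ∙ b = toUnit (⊗≢0 (unit≢0 a) (unit≢0 b))

  unit-∙ : ∀ a b → unit (a ∙ b) ≡ unit a ⊗ unit b
  unit-∙ a b = unit-toUnit (⊗≢0 (unit≢0 a) (unit≢0 b))

  one : Fin s
  one = toUnit (0≢1 ∘ sym)

  unit-one : unit one ≡ 1#
  unit-one = unit-toUnit (0≢1 ∘ sym)

  private
    inverse≢0 : ∀ c → proj₁ (inverse (unit c) (unit≢0 c)) ≢ 0#
    inverse≢0 c eq = 0≢1 (trans (sym (trans (cong (unit c ⊗_) eq) (K.zeroʳ (unit c)))) (proj₂ (inverse (unit c) (unit≢0 c))))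

  inv : Fin s → Fin s
  inv c = toUnit (inverse≢0 c)

  unit-inv : ∀ c → unit c ⊗ unit (inv c) ≡ 1#
  unit-inv c = trans (cong (unit c ⊗_) (unit-toUnit (inverse≢0 c))) (proj₂ (inverse (unit c) (unit≢0 c)))

  inv-unit : ∀ c → unit (inv c) ⊗ unit c ≡ 1#
  inv-unit c = trans (K.*-comm (unit (inv c)) (unit c)) (unit-inv c)

  inv-unique : ∀ c y → unit c ⊗ unit y ≡ 1# → inv y ≡ c
  inv-unique c y eq = unit-injective (⊗-cancelˡ (unit y) (unit≢0 y)
    (trans (unit-inv y) (trans (sym eq) (K.*-comm (unit c) (unit y)))))

  inv-involutive : ∀ c → inv (inv c) ≡ c
  inv-involutive c = inv-unique c (inv c) (unit-inv c)

  ∙-∙inv : ∀ b a → (a ∙ b) ∙ inv b ≡ a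
  ∙-∙inv b a = unit-injective (trans (unit-∙ (a ∙ b) (inv b)) (trans (cong (_⊗ unit (inv b)) (unit-∙ a b))
    (trans (K.*-assoc (unit a) (unit b) (unit (inv b))) (trans (cong (unit a ⊗_) (unit-inv b)) (K.*-identityʳ (unit a))))))

  ∙inv-∙ : ∀ b a → (a ∙ inv b) ∙ b ≡ a
  ∙inv-∙ b a = trans (cong (a ∙ inv b ∙_) (sym (inv-involutive b))) (∙-∙inv (inv b) a)

  actRow : ∀ {n} → Fin s → Vec (Fin s) n → Row n → Row n
  actRow c = Vec.zipWith (λ y x → unit c ⊗ x ⊗ unit y)

  act : ∀ {r n} → Vec (Fin s) r → Vec (Fin s) n → Rows r n → Rows r n
  act d e = Vec.zipWith (λ c → actRow c e) d

  _∙ᵥ_ : ∀ {n} → Vec (Fin s) n → Vec (Fin s) n → Vec (Fin s) n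
  _∙ᵥ_ = Vec.zipWith _∙_

  act-∙ : ∀ {r n} (d d′ : Vec (Fin s) r) (e e′ : Vec (Fin s) n) A → act (d ∙ᵥ d′) (e ∙ᵥ e′) A ≡ act d e (act d′ e′ A)
  act-∙ []      []        e e′ []      = refl
  act-∙ (c ∷ d) (c′ ∷ d′) e e′ (w ∷ A) = cong₂ _∷_ (row e e′ w) (act-∙ d d′ e e′ A)
    where
    row : ∀ {n} (e e′ : Vec (Fin s) n) w → actRow (c ∙ c′) (e ∙ᵥ e′) w ≡ actRow c e (actRow c′ e′ w)
    row []      []        []      = refl
    row (y ∷ e) (y′ ∷ e′) (x ∷ w) = cong₂ _∷_ (trans (cong₂ (λ p r → p ⊗ x ⊗ r) (unit-∙ c c′) (unit-∙ y y′))
      (solve 5 (λ c c′ x y y′ → c :* c′ :* x :* (y :* y′) := c :* (c′ :* x :* y′) :* y) refl (unit c) (unit c′) x (unit y) (unit y′)))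
      (row e e′ w)
      where open Solver

  1ᵥ : ∀ {n} → Vec (Fin s) n
  1ᵥ {n} = Vec.replicate n one

  act-1 : ∀ {r n} (A : Rows r n) → act 1ᵥ 1ᵥ A ≡ A
  act-1 []      = refl
  act-1 (w ∷ A) = cong₂ _∷_ (row w) (act-1 A)
    where
    row : ∀ {n} (w : Row n) → actRow one 1ᵥ w ≡ w
    row []      = refl
    row (x ∷ w) = cong₂ _∷_ (trans (cong (λ u → u ⊗ x ⊗ u) unit-one) (trans (K.*-identityʳ (1# ⊗ x)) (K.*-identityˡ x))) (row w)

  act-inv : ∀ {r n} (d : Vec (Fin s) r) (e : Vec (Fin s) n) A → act (Vec.map inv d) (Vec.map inv e) (act d e A) ≡ A
  act-inv []      e []      = refl
  act-inv (c ∷ d) e (w ∷ A) = cong₂ _∷_ (row e w) (act-inv d e A)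
    where
    row : ∀ {n} (e : Vec (Fin s) n) w → actRow (inv c) (Vec.map inv e) (actRow c e w) ≡ w
    row []      []      = refl
    row (y ∷ e) (x ∷ w) = cong₂ _∷_
      (trans (solve 5 (λ c c′ x y y′ → c′ :* (c :* x :* y) :* y′ := c :* c′ :* (y :* y′) :* x) refl (unit c) (unit (inv c)) x (unit y) (unit (inv y)))
        (trans (cong₂ (λ p r → p ⊗ r ⊗ x) (unit-inv c) (unit-inv y)) (trans (cong (_⊗ x) (K.*-identityˡ 1#)) (K.*-identityˡ x))))
      (row e w)
      where open Solver

  ∙ᵥ-∙inv : ∀ {n} (b a : Vec (Fin s) n) → (a ∙ᵥ b) ∙ᵥ Vec.map inv b ≡ a
  ∙ᵥ-∙inv []      []      = refl
  ∙ᵥ-∙inv (y ∷ b) (x ∷ a) = cong₂ _∷_ (∙-∙inv y x) (∙ᵥ-∙inv b a)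

  ∙ᵥinv-∙ : ∀ {n} (b a : Vec (Fin s) n) → (a ∙ᵥ Vec.map inv b) ∙ᵥ b ≡ a
  ∙ᵥinv-∙ []      []      = refl
  ∙ᵥinv-∙ (y ∷ b) (x ∷ a) = cong₂ _∷_ (∙inv-∙ y x) (∙ᵥinv-∙ b a)

  scale : ∀ {n} → Vec (Fin s) n → Row n → Row n
  scale = Vec.zipWith (λ y x → x ⊗ unit y)

  scale-injective : ∀ {n} (e : Vec (Fin s) n) z → scale e z ≡ 0ᵥ → z ≡ 0ᵥ
  scale-injective []      []      _  = refl
  scale-injective (y ∷ e) (x ∷ z) eq = cong₂ _∷_
    (⊗-cancelˡ (unit y) (unit≢0 y) (trans (K.*-comm (unit y) x) (trans (VecP.∷-injectiveˡ eq) (sym (K.zeroʳ (unit y))))))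
    (scale-injective e z (VecP.∷-injectiveʳ eq))

  scale-0 : ∀ {n} (e : Vec (Fin s) n) → scale e 0ᵥ ≡ 0ᵥ
  scale-0 []      = refl
  scale-0 (y ∷ e) = cong₂ _∷_ (K.zeroˡ (unit y)) (scale-0 e)

  -- Associativity in the form `v (D A E) = ((v D) A) E`, the diagonal factors acting on rows by
  -- `scale`.
  ⊛-act : ∀ {r n} (d : Vec (Fin s) r) (e : Vec (Fin s) n) v A → v ⊛ act d e A ≡ scale e (scale d v ⊛ A)
  ⊛-act []      e []      []      = sym (scale-0 e)
  ⊛-act (c ∷ d) e (x ∷ v) (w ∷ A) = trans (cong (x ⊙ actRow c e w ⊞_) (⊛-act d e v A)) (row e w (scale d v ⊛ A))
    where
    row : ∀ {n} (e : Vec (Fin s) n) w z → x ⊙ actRow c e w ⊞ scale e z ≡ scale e ((x ⊗ unit c) ⊙ w ⊞ z)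
    row []      []      []      = refl
    row (y ∷ e) (a ∷ w) (b ∷ z) = cong₂ _∷_
      (solve 5 (λ x c a y b → x :* (c :* a :* y) :+ b :* y := (x :* c :* a :+ b) :* y) refl x (unit c) a (unit y) b) (row e w z)
      where open Solver

  independent-act : ∀ {r n} (d : Vec (Fin s) r) (e : Vec (Fin s) n) {A} → Independent A → Independent (act d e A)
  independent-act d e {A} ind v eq = scale-injective d v
    (ind (scale d v) (scale-injective e _ (trans (sym (⊛-act d e v A)) eq)))

  -- A nonzero entry `x` cancels from `c x y = x` and leaves `c y = 1`, so it can occur only where
  -- the row colour is the inverse of the column unit.
  fixed⇒coloured : ∀ {r n} (d : Vec (Fin s) r) (e : Vec (Fin s) n) A → act d e A ≡ A → Coloured d (Vec.map inv e) A
  fixed⇒coloured []      e []      _  = _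
  fixed⇒coloured (c ∷ d) e (w ∷ A) eq = row e w (VecP.∷-injectiveˡ eq) , fixed⇒coloured d e A (VecP.∷-injectiveʳ eq)
    where
    row : ∀ {n} (e : Vec (Fin s) n) w → actRow c e w ≡ w → Supported c (Vec.map inv e) w
    row []      []      _  = _
    row (y ∷ e) (x ∷ w) eq = entry , row e w (VecP.∷-injectiveʳ eq)
      where
      open Solver
      entry : inv y ≢ c → x ≡ 0#
      entry y⁻¹≢c with x Fin.≟ 0#
      ... | yes x≡0 = x≡0
      ... | no x≢0  = contradiction (inv-unique c y (⊗-cancelˡ x x≢0
        (trans (solve 3 (λ c x y → x :* (c :* y) := c :* x :* y) refl (unit c) x (unit y))
          (trans (VecP.∷-injectiveˡ eq) (sym (K.*-identityʳ x)))))) y⁻¹≢c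

  coloured⇒fixed : ∀ {r n} (d : Vec (Fin s) r) (e : Vec (Fin s) n) A → Coloured d (Vec.map inv e) A → act d e A ≡ A
  coloured⇒fixed []      e []      _         = refl
  coloured⇒fixed (c ∷ d) e (w ∷ A) (hw , hA) = cong₂ _∷_ (row e w hw) (coloured⇒fixed d e A hA)
    where
    row : ∀ {n} (e : Vec (Fin s) n) w → Supported c (Vec.map inv e) w → actRow c e w ≡ w
    row []      []      _          = refl
    row (y ∷ e) (x ∷ w) (x≡0 , hw) = cong₂ _∷_ entry (row e w hw)
      where
      open Solver
      entry : unit c ⊗ x ⊗ unit y ≡ x
      entry with inv y Fin.≟ c
      ... | yes refl = trans (solve 3 (λ c x y → c :* x :* y := c :* y :* x) refl (unit (inv y)) x (unit y))
            (trans (cong (_⊗ x) (inv-unit y)) (K.*-identityˡ x))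
      ... | no y⁻¹≢c = subst (λ x → unit c ⊗ x ⊗ unit y ≡ x) (sym (x≡0 y⁻¹≢c)) (trans (cong (_⊗ unit y) (K.zeroʳ (unit c))) (K.zeroˡ (unit y)))

  module _ (n : ℕ) where

    private
      colours = vecs-finite (fins s) n

    open Burnside (matrices n n) (pairs colours colours)
      (λ (d , e) (d′ , e′) → d ∙ᵥ d′ , e ∙ᵥ e′) (1ᵥ , 1ᵥ) (λ (d , e) → Vec.map inv d , Vec.map inv e) (λ (d , e) → act d e)
      (λ (d , e) (d′ , e′) → act-∙ d d′ e e′) act-1 (λ (d , e) → act-inv d e)
      (λ (d , e) (d′ , e′) → cong₂ _,_ (∙ᵥ-∙inv d d′) (∙ᵥ-∙inv e e′))
      (λ (d , e) (d′ , e′) → cong₂ _,_ (∙ᵥinv-∙ d d′) (∙ᵥinv-∙ e e′))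
      Independent independent? (λ (d , e) → independent-act d e) public

    orbit-count : ι (length reps) * ι (s ℕ.^ (2 ℕ.* n)) ≡ Colourings.total (suc s) s n n
    orbit-count = begin
      ι (length reps) * ι (s ℕ.^ (2 ℕ.* n))
        ≡⟨ cong (ι (length reps) *_) group-order ⟨
      ι (length reps) * Sum (elements (pairs colours colours)) (λ _ → 1ℚ)
        ≡⟨ burnside ⟩
      Sum (elements (pairs colours colours)) (λ (d , e) → Sum Ms (λ A → 𝟙 (independent? A) * 𝟙 (act d e A ≟ₘ A)))
        ≡⟨ Sum-pairs colours colours _ ⟩
      Sum cs (λ d → Sum cs (λ e → Sum Ms (λ A → 𝟙 (independent? A) * 𝟙 (act d e A ≟ₘ A))))
        ≡⟨ Sum-cong cs (λ d → Sum-cong cs (λ e → trans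
             (Sum-cong Ms (λ A → cong (𝟙 (independent? A) *_) (𝟙-⇔ (act d e A ≟ₘ A) (coloured? d (Vec.map inv e) A)
               (fixed⇒coloured d e A) (coloured⇒fixed d e A))))
             (Sum-coloured d (Vec.map inv e)))) ⟩
      Sum cs (λ d → Sum cs (λ e → coloured d (Vec.map inv e)))
        -- Inversion permutes the column colourings, so it disappears under the sum over all `e`.
        ≡⟨ Sum-cong cs (λ d → reindex colours colours (Vec.map inv) (Vec.map inv) involutive involutive (coloured d)) ⟩
      Sum cs (λ d → Sum cs (λ e → coloured d e))
        ≡⟨ Sum-cong cs (λ d → Sum-cong cs (λ e → coloured-block d e)) ⟩
      total s n n ∎
      where
      open ≡-Reasoning
      open Colourings (suc s)
      open Finite (matrices n n) using () renaming (_≟_ to _≟ₘ_)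
      cs = elements colours
      Ms = elements (matrices n n)
      involutive : ∀ e → Vec.map inv (Vec.map inv e) ≡ e
      involutive e = trans (sym (VecP.map-∘ inv inv e)) (trans (VecP.map-cong inv-involutive e) (VecP.map-id e))
      colours-order : Sum cs (λ _ → 1ℚ) ≡ ι (s ℕ.^ n)
      colours-order = trans (length-words (allFin s) n) (cong (λ k → ι (k ℕ.^ n)) (ListP.length-tabulate {n = s} id))
      group-order : Sum (elements (pairs colours colours)) (λ _ → 1ℚ) ≡ ι (s ℕ.^ (2 ℕ.* n))
      group-order = begin
        Sum (elements (pairs colours colours)) (λ _ → 1ℚ)
          ≡⟨ Sum-pairs colours colours (λ _ → 1ℚ) ⟩
        Sum cs (λ _ → Sum cs (λ _ → 1ℚ))
          ≡⟨ trans (Sum-cong cs (λ _ → sym (ℚP.*-identityˡ (Sum cs (λ _ → 1ℚ))))) (Sum-*ʳ cs (Sum cs (λ _ → 1ℚ)) (λ _ → 1ℚ)) ⟩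
        Sum cs (λ _ → 1ℚ) * Sum cs (λ _ → 1ℚ)
          ≡⟨ cong₂ _*_ colours-order colours-order ⟩
        ι (s ℕ.^ n) * ι (s ℕ.^ n)
          ≡⟨ ι-* (s ℕ.^ n) (s ℕ.^ n) ⟨
        ι (s ℕ.^ n ℕ.* s ℕ.^ n)
          ≡⟨ cong ι (ℕP.^-distribˡ-+-* s n n) ⟨
        ι (s ℕ.^ (n ℕ.+ n))
          ≡⟨ cong (λ k → ι (s ℕ.^ (n ℕ.+ k))) (ℕP.+-identityʳ n) ⟨
        ι (s ℕ.^ (2 ℕ.* n)) ∎

-- Transfer to an arbitrary finite field.

lookup-extensional : ∀ {a} {A : Set a} {n} {u v : Vec A n} → (∀ i → lookup u i ≡ lookup v i) → u ≡ v
lookup-extensional {u = u} {v} eq = trans (sym (VecP.tabulate∘lookup u)) (trans (VecP.tabulate-cong eq) (VecP.tabulate∘lookup v))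

module Enumerated {c ℓ s} (𝐅 : FiniteField c ℓ (suc s)) where

  private
    module F = FiniteField 𝐅
    module ΣF = SemiringSum (CommutativeRing.semiring F.commRing)
    K = Fin (suc s)

  open F using (Carrier; _≈_; enum; enum-injective)
  open Matrices 𝐅

  infixl 7 _×ᶠ_
  _×ᶠ_ : Carrier → Carrier → Carrier
  _×ᶠ_ = F._*_

  index : Carrier → K
  index x = proj₁ (F.enum-surjective x)

  enum-index : ∀ x → enum (index x) ≈ x
  enum-index x = proj₂ (F.enum-surjective x)

  -- The operations are pulled back along the enumeration, which makes `enum` an injective ring
  -- homomorphism; the ring laws on `Fin` are inherited through it.
  𝔽 : FieldOnFin (suc s)
  𝔽 = record
    { _⊕_ = RawRing._+_ raw ; _⊗_ = RawRing._*_ raw ; ⊖_ = RawRing.-_ raw ; 0# = RawRing.0# raw ; 1# = RawRing.1# raw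
    ; isCommutativeRing = RingMonomorphism.isCommutativeRing monomorphism (CommutativeRing.isCommutativeRing F.commRing)
    ; 0≢1     = λ eq → F.0≉1 (F.trans (F.sym (enum-index F.0#)) (F.trans (F.reflexive (cong enum eq)) (enum-index F.1#)))
    ; inverse = λ x x≢0 →
        let y , xy≈1 = F.inverse (enum x) (λ x≈0 → x≢0 (enum-injective x (index F.0#) (F.trans x≈0 (F.sym (enum-index F.0#)))))
        in index y , enum-injective _ _ (F.trans (enum-index _) (F.trans (F.*-cong F.refl (enum-index y))
             (F.trans xy≈1 (F.sym (enum-index F.1#)))))
    }
    where
    raw : RawRing _ _
    raw = record
      { Carrier = K ; _≈_ = _≡_
      ; _+_ = λ x y → index (enum x F.+ enum y) ; _*_ = λ x y → index (enum x F.* enum y)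
      ; -_ = λ x → index (F.- enum x) ; 0# = index F.0# ; 1# = index F.1# }
    monomorphism : IsRingMonomorphism raw (CommutativeRing.rawRing F.commRing) enum
    monomorphism = record
      { isRingHomomorphism = record
        { isSemiringHomomorphism = record
          { isNearSemiringHomomorphism = record
            { +-isMonoidHomomorphism = record
              { isMagmaHomomorphism = record
                { isRelHomomorphism = record { cong = λ eq → F.reflexive (cong enum eq) }
                ; homo = λ x y → enum-index _ }
              ; ε-homo = enum-index F.0# }
            ; *-homo = λ x y → enum-index _ }
          ; 1#-homo = enum-index F.1# }
        ; -‿homo = λ x → enum-index _ }
      ; injective = enum-injective _ _ }

  open FieldOnFin 𝔽
  open LinearAlgebra 𝔽
  open DiagonalAction 𝔽

  enum-⊗ : ∀ x y → enum (x ⊗ y) ≈ enum x ×ᶠ enum y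
  enum-⊗ x y = enum-index _

  enum-⊕ : ∀ x y → enum (x ⊕ y) ≈ enum x F.+ enum y
  enum-⊕ x y = enum-index _

  ∑≡sum : ∀ {n} (f : Fin n → Carrier) → ∑ f ≡ ΣF.sum f
  ∑≡sum {zero}  f = refl
  ∑≡sum {suc n} f = cong (f Fin.zero F.+_) (∑≡sum (f ∘ Fin.suc))

  ∑-cong : ∀ {n} {f g : Fin n → Carrier} → (∀ i → f i ≈ g i) → ∑ f ≈ ∑ g
  ∑-cong {zero}  eq = F.refl
  ∑-cong {suc n} eq = F.+-cong (eq Fin.zero) (∑-cong (eq ∘ Fin.suc))

  ∑-swap : ∀ {m n} (f : Fin m → Fin n → Carrier) → ∑ (λ i → ∑ (f i)) ≈ ∑ (λ j → ∑ (λ i → f i j))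
  ∑-swap f = begin
    ∑ (λ i → ∑ (f i))                  ≈⟨ ∑-cong (λ i → F.reflexive (∑≡sum (f i))) ⟩
    ∑ (λ i → ΣF.sum (f i))             ≡⟨ ∑≡sum (λ i → ΣF.sum (f i)) ⟩
    ΣF.sum (λ i → ΣF.sum (f i))        ≈⟨ ΣF.∑-comm f ⟩
    ΣF.sum (λ j → ΣF.sum (λ i → f i j)) ≡⟨ ∑≡sum (λ j → ΣF.sum (λ i → f i j)) ⟨
    ∑ (λ j → ΣF.sum (λ i → f i j))     ≈⟨ ∑-cong (λ j → F.reflexive (∑≡sum (λ i → f i j))) ⟨
    ∑ (λ j → ∑ (λ i → f i j))          ∎
    where open SetoidReasoning F.setoid

  ∑-*ˡ : ∀ {n} x (f : Fin n → Carrier) → ∑ (λ i → x ×ᶠ f i) ≈ x ×ᶠ ∑ f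
  ∑-*ˡ x f = F.trans (F.reflexive (∑≡sum (λ i → x ×ᶠ f i))) (F.trans (F.sym (ΣF.*-distribˡ-sum x f)) (F.*-cong F.refl (F.reflexive (sym (∑≡sum f)))))

  ∑-*ʳ : ∀ {n} x (f : Fin n → Carrier) → ∑ (λ i → f i ×ᶠ x) ≈ ∑ f ×ᶠ x
  ∑-*ʳ x f = F.trans (F.reflexive (∑≡sum (λ i → f i ×ᶠ x))) (F.trans (F.sym (ΣF.*-distribʳ-sum x f)) (F.*-cong (F.reflexive (sym (∑≡sum f))) F.refl))

  ∑-zero : ∀ {n} {f : Fin n → Carrier} → (∀ i → f i ≈ F.0#) → ∑ f ≈ F.0#
  ∑-zero {zero}  eq = F.refl
  ∑-zero {suc n} eq = F.trans (F.+-cong (eq Fin.zero) (∑-zero (eq ∘ Fin.suc))) (F.+-identityˡ F.0#)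

  ∑-single : ∀ {n} i {f : Fin n → Carrier} → (∀ k → k ≢ i → f k ≈ F.0#) → ∑ f ≈ f i
  ∑-single Fin.zero    zeros = F.trans (F.+-cong F.refl (∑-zero (λ k → zeros (Fin.suc k) (λ ())))) (F.+-identityʳ _)
  ∑-single (Fin.suc i) zeros = F.trans
    (F.+-cong (zeros Fin.zero (λ ())) (∑-single i (λ k k≢i → zeros (Fin.suc k) (k≢i ∘ FinP.suc-injective)))) (F.+-identityˡ _)

  I-≡ : ∀ {n} (i : Fin n) → I i i ≈ F.1#
  I-≡ i with i Fin.≟ i
  ... | yes _  = F.refl
  ... | no i≢i = contradiction refl i≢i

  I-≢ : ∀ {n} {i j : Fin n} → i ≢ j → I i j ≈ F.0#
  I-≢ {i = i} {j} i≢j with i Fin.≟ j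
  ... | yes i≡j = contradiction i≡j i≢j
  ... | no _    = F.refl

  Diagonal : ∀ {n} → Mat n → Set ℓ
  Diagonal D = ∀ i j → i ≢ j → D i j ≈ F.0#

  diagonal-·ˡ : ∀ {n} {D : Mat n} → Diagonal D → ∀ A i j → (D · A) i j ≈ D i i ×ᶠ A i j
  diagonal-·ˡ diag A i j = ∑-single i (λ k k≢i → F.trans (F.*-cong (diag i k (k≢i ∘ sym)) F.refl) (F.zeroˡ (A k j)))

  diagonal-·ʳ : ∀ {n} {D : Mat n} → Diagonal D → ∀ A i j → (A · D) i j ≈ A i j ×ᶠ D j j
  diagonal-·ʳ diag A i j = ∑-single j (λ k k≢j → F.trans (F.*-cong F.refl (diag k j k≢j)) (F.zeroʳ (A i k)))

  I-diagonal : ∀ {n} → Diagonal (I {n})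
  I-diagonal i j = I-≢

  ·-identityˡ : ∀ {n} (A : Mat n) → (I · A) ≋ A
  ·-identityˡ A i j = F.trans (diagonal-·ˡ I-diagonal A i j) (F.trans (F.*-cong (I-≡ i) F.refl) (F.*-identityˡ (A i j)))

  ·-identityʳ : ∀ {n} (A : Mat n) → (A · I) ≋ A
  ·-identityʳ A i j = F.trans (diagonal-·ʳ I-diagonal A i j) (F.trans (F.*-cong F.refl (I-≡ j)) (F.*-identityʳ (A i j)))

  ·-cong : ∀ {n} {A A′ B B′ : Mat n} → A ≋ A′ → B ≋ B′ → (A · B) ≋ (A′ · B′)
  ·-cong p q i j = ∑-cong (λ k → F.*-cong (p i k) (q k j))

  ·-assoc : ∀ {n} (A B C : Mat n) → ((A · B) · C) ≋ (A · (B · C))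
  ·-assoc A B C i j = begin
    ∑ (λ k → ∑ (λ l → A i l ×ᶠ B l k) ×ᶠ C k j)    ≈⟨ ∑-cong (λ k → F.sym (∑-*ʳ (C k j) (λ l → A i l ×ᶠ B l k))) ⟩
    ∑ (λ k → ∑ (λ l → A i l ×ᶠ B l k ×ᶠ C k j))    ≈⟨ ∑-swap (λ k l → A i l ×ᶠ B l k ×ᶠ C k j) ⟩
    ∑ (λ l → ∑ (λ k → A i l ×ᶠ B l k ×ᶠ C k j))    ≈⟨ ∑-cong (λ l → ∑-cong (λ k → F.*-assoc (A i l) (B l k) (C k j))) ⟩
    ∑ (λ l → ∑ (λ k → A i l ×ᶠ (B l k ×ᶠ C k j)))  ≈⟨ ∑-cong (λ l → ∑-*ˡ (A i l) (λ k → B l k ×ᶠ C k j)) ⟩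
    ∑ (λ l → A i l ×ᶠ ∑ (λ k → B l k ×ᶠ C k j))    ∎
    where open SetoidReasoning F.setoid

  fromRow : ∀ {n} → Row n → Fin n → Carrier
  fromRow v j = enum (lookup v j)

  toRow : ∀ {n} → (Fin n → Carrier) → Row n
  toRow f = tabulate (index ∘ f)

  fromRow-toRow : ∀ {n} (f : Fin n → Carrier) j → fromRow (toRow f) j ≈ f j
  fromRow-toRow f j = F.trans (F.reflexive (cong enum (VecP.lookup∘tabulate (index ∘ f) j))) (enum-index (f j))

  fromRow-injective : ∀ {n} (u v : Row n) → (∀ j → fromRow u j ≈ fromRow v j) → u ≡ v
  fromRow-injective u v eq = lookup-extensional ((λ j → enum-injective (lookup u j) (lookup v j) (eq j)))

  fromRow-0 : ∀ {n} (j : Fin n) → fromRow 0ᵥ j ≈ F.0#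
  fromRow-0 j = F.trans (F.reflexive (cong enum (VecP.lookup-replicate j 0#))) (enum-index F.0#)

  fromRows : ∀ {n} → Rows n n → Mat n
  fromRows A i = fromRow (lookup A i)

  toRows : ∀ {n} → Mat n → Rows n n
  toRows A = tabulate (λ i → toRow (A i))

  fromRows-toRows : ∀ {n} (A : Mat n) → fromRows (toRows A) ≋ A
  fromRows-toRows A i j = F.trans (F.reflexive (cong (λ w → fromRow w j) (VecP.lookup∘tabulate (λ i → toRow (A i)) i))) (fromRow-toRow (A i) j)

  fromRow-⊛ : ∀ {r n} (v : Row r) (A : Rows r n) j → fromRow (v ⊛ A) j ≈ ∑ (λ i → fromRow v i ×ᶠ fromRow (lookup A i) j)
  fromRow-⊛ []      []      j = fromRow-0 j
  fromRow-⊛ (x ∷ v) (w ∷ A) j = begin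
    enum (lookup (x ⊙ w ⊞ v ⊛ A) j)               ≡⟨ cong enum (trans (VecP.lookup-zipWith _⊕_ j (x ⊙ w) (v ⊛ A)) (cong (_⊕ lookup (v ⊛ A) j) (VecP.lookup-map j (x ⊗_) w))) ⟩
    enum (x ⊗ lookup w j ⊕ lookup (v ⊛ A) j)      ≈⟨ enum-⊕ (x ⊗ lookup w j) (lookup (v ⊛ A) j) ⟩
    enum (x ⊗ lookup w j) F.+ fromRow (v ⊛ A) j   ≈⟨ F.+-cong (enum-⊗ x (lookup w j)) (fromRow-⊛ v A j) ⟩
    enum x ×ᶠ fromRow w j F.+ ∑ (λ i → fromRow v i ×ᶠ fromRow (lookup A i) j) ∎
    where open SetoidReasoning F.setoid

  GL⇒independent : ∀ {n} (A : Rows n n) → GL n (fromRows A) → Independent A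
  GL⇒independent {n} A (B , AB≈I , _) v vA≡0 = fromRow-injective v 0ᵥ (λ j → begin
    V j j                              ≈⟨ ·-identityʳ V j j ⟨
    (V · I) j j                        ≈⟨ ·-cong {A = V} (λ _ _ → F.refl) AB≈I j j ⟨
    (V · (fromRows A · B)) j j         ≈⟨ ·-assoc V (fromRows A) B j j ⟨
    ((V · fromRows A) · B) j j         ≈⟨ ∑-zero (λ k → F.trans (F.*-cong (VA≈0 j k) F.refl) (F.zeroˡ (B k j))) ⟩
    F.0#                               ≈⟨ fromRow-0 j ⟨
    fromRow 0ᵥ j                       ∎)
    where
    open SetoidReasoning F.setoid
    -- A square matrix with all rows equal to `v` brings a single row within reach of the identities
    -- for square matrices: `V = V A B = 0`.
    V : Mat n
    V i = fromRow v
    VA≈0 : ∀ i k → (V · fromRows A) i k ≈ F.0#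
    VA≈0 i k = F.trans (F.sym (fromRow-⊛ v A k)) (F.trans (F.reflexive (cong (λ w → fromRow w k) vA≡0)) (fromRow-0 k))

  -- The coordinates of the unit rows form a left inverse `B`. Then `(A B) A = A = I A`, and
  -- independence cancels the right-hand factor `A` row by row, so `B` is also a right inverse.
  independent⇒GL : ∀ {n} (A : Rows n n) → Independent A → GL n (fromRows A)
  independent⇒GL {n} A ind = B , AB≈I , BA≈I
    where
    open SetoidReasoning F.setoid
    A′ = fromRows A
    solution : ∀ i → Span A (toRow (I i))
    solution i = independent-spans A ind (toRow (I i))
    B : Mat n
    B i = fromRow (proj₁ (solution i))
    BA≈I : (B · A′) ≋ I
    BA≈I i j = begin
      (B · A′) i j                             ≈⟨ fromRow-⊛ (proj₁ (solution i)) A j ⟨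
      fromRow (proj₁ (solution i) ⊛ A) j       ≡⟨ cong (λ w → fromRow w j) (proj₂ (solution i)) ⟩
      fromRow (toRow (I i)) j                  ≈⟨ fromRow-toRow (I i) j ⟩
      I i j                                    ∎
    toRow-⊛ : ∀ (X : Mat n) i j → fromRow (toRow (X i) ⊛ A) j ≈ (X · A′) i j
    toRow-⊛ X i j = F.trans (fromRow-⊛ (toRow (X i)) A j) (∑-cong (λ k → F.*-cong (fromRow-toRow (X i) k) F.refl))
    AB·A≈I·A : ∀ i j → ((A′ · B) · A′) i j ≈ (I · A′) i j
    AB·A≈I·A i j = begin
      ((A′ · B) · A′) i j   ≈⟨ ·-assoc A′ B A′ i j ⟩
      (A′ · (B · A′)) i j   ≈⟨ ·-cong {A = A′} (λ _ _ → F.refl) BA≈I i j ⟩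
      (A′ · I) i j          ≈⟨ ·-identityʳ A′ i j ⟩
      A′ i j                ≈⟨ ·-identityˡ A′ i j ⟨
      (I · A′) i j          ∎
    AB≈I : (A′ · B) ≋ I
    AB≈I i j = begin
      (A′ · B) i j                      ≈⟨ fromRow-toRow ((A′ · B) i) j ⟨
      fromRow (toRow ((A′ · B) i)) j    ≡⟨ cong (λ w → fromRow w j) (independent-injective A ind {toRow ((A′ · B) i)} {toRow (I i)} (fromRow-injective _ _
                                             (λ j → F.trans (toRow-⊛ (A′ · B) i j) (F.trans (AB·A≈I·A i j) (F.sym (toRow-⊛ I i j)))))) ⟩
      fromRow (toRow (I i)) j           ≈⟨ fromRow-toRow (I i) j ⟩
      I i j                             ∎

  GL-resp : ∀ {n} {A A′ : Mat n} → A ≋ A′ → GL n A → GL n A′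
  GL-resp A≋A′ (B , AB≈I , BA≈I) = B
    , (λ i j → F.trans (·-cong {B = B} (λ i j → F.sym (A≋A′ i j)) (λ _ _ → F.refl) i j) (AB≈I i j))
    , (λ i j → F.trans (·-cong {A = B} (λ _ _ → F.refl) (λ i j → F.sym (A≋A′ i j)) i j) (BA≈I i j))

  diagonal-sandwich : ∀ {n} {D E : Mat n} → Diagonal D → Diagonal E → ∀ A i j → ((D · A) · E) i j ≈ D i i ×ᶠ A i j ×ᶠ E j j
  diagonal-sandwich {D = D} diagD diagE A i j = F.trans (diagonal-·ʳ diagE (D · A) i j) (F.*-cong (diagonal-·ˡ diagD A i j) F.refl)

  -- Whatever the inverse `E` looks like, the entry of `D · E` at `(i, i)` is `D i i` times `E i i`,
  -- so `D i i` divides 1.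
  diagonal≉0 : ∀ {n} {D : Mat n} → Δ n D → ∀ i → ¬ D i i ≈ F.0#
  diagonal≉0 {D = D} (diag , E , DE≈I , _) i Dᵢᵢ≈0 = F.0≉1 (begin
    F.0#                ≈⟨ F.zeroˡ (E i i) ⟨
    F.0# ×ᶠ E i i       ≈⟨ F.*-cong Dᵢᵢ≈0 F.refl ⟨
    D i i ×ᶠ E i i      ≈⟨ diagonal-·ˡ diag E i i ⟨
    (D · E) i i         ≈⟨ DE≈I i i ⟩
    I i i               ≈⟨ I-≡ i ⟩
    F.1#                ∎)
    where open SetoidReasoning F.setoid

  index≢0 : ∀ {x} → ¬ x ≈ F.0# → index x ≢ 0#
  index≢0 {x} x≉0 eq = x≉0 (F.trans (F.sym (enum-index x)) (F.trans (F.reflexive (cong enum eq)) (enum-index F.0#)))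

  units : ∀ {n} {D : Mat n} → Δ n D → Vec (Fin s) n
  units ΔD = tabulate (λ i → toUnit (index≢0 (diagonal≉0 ΔD i)))

  enum-units : ∀ {n} {D : Mat n} (ΔD : Δ n D) i → enum (unit (lookup (units ΔD) i)) ≈ D i i
  enum-units {D = D} ΔD i = F.trans (F.reflexive (cong enum (trans
    (cong unit (VecP.lookup∘tabulate (λ i → toUnit (index≢0 (diagonal≉0 ΔD i))) i))
    (unit-toUnit (index≢0 (diagonal≉0 ΔD i)))))) (enum-index (D i i))

  diagonalMatrix : ∀ {n} → Vec (Fin s) n → Mat n
  diagonalMatrix d i j = enum (unit (lookup d i)) ×ᶠ I i j

  diagonalMatrix-diagonal : ∀ {n} (d : Vec (Fin s) n) → Diagonal (diagonalMatrix d)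
  diagonalMatrix-diagonal d i j i≢j = F.trans (F.*-cong F.refl (I-≢ i≢j)) (F.zeroʳ _)

  diagonalMatrix-≡ : ∀ {n} (d : Vec (Fin s) n) i → diagonalMatrix d i i ≈ enum (unit (lookup d i))
  diagonalMatrix-≡ d i = F.trans (F.*-cong F.refl (I-≡ i)) (F.*-identityʳ _)

  diagonalMatrix-inverse : ∀ {n} (d e : Vec (Fin s) n) → (∀ i → unit (lookup d i) ⊗ unit (lookup e i) ≡ 1#) →
    (diagonalMatrix d · diagonalMatrix e) ≋ I
  diagonalMatrix-inverse d e de≡1 i j = begin
    (diagonalMatrix d · diagonalMatrix e) i j                           ≈⟨ diagonal-·ˡ (diagonalMatrix-diagonal d) (diagonalMatrix e) i j ⟩
    diagonalMatrix d i i ×ᶠ (enum (unit (lookup e i)) ×ᶠ I i j)         ≈⟨ F.*-assoc _ _ _ ⟨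
    diagonalMatrix d i i ×ᶠ enum (unit (lookup e i)) ×ᶠ I i j           ≈⟨ F.*-cong (F.*-cong (diagonalMatrix-≡ d i) F.refl) F.refl ⟩
    enum (unit (lookup d i)) ×ᶠ enum (unit (lookup e i)) ×ᶠ I i j       ≈⟨ F.*-cong (enum-⊗ _ _) F.refl ⟨
    enum (unit (lookup d i) ⊗ unit (lookup e i)) ×ᶠ I i j               ≈⟨ F.*-cong (F.trans (F.reflexive (cong enum (de≡1 i))) (enum-index F.1#)) F.refl ⟩
    F.1# ×ᶠ I i j                                                       ≈⟨ F.*-identityˡ (I i j) ⟩
    I i j                                                               ∎
    where open SetoidReasoning F.setoid

  diagonalMatrix-Δ : ∀ {n} (d : Vec (Fin s) n) → Δ n (diagonalMatrix d)
  diagonalMatrix-Δ d = diagonalMatrix-diagonal d , diagonalMatrix (Vec.map inv d)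
    , diagonalMatrix-inverse d (Vec.map inv d) (λ i → trans (cong (λ y → unit (lookup d i) ⊗ unit y) (VecP.lookup-map i inv d)) (unit-inv _))
    , diagonalMatrix-inverse (Vec.map inv d) d (λ i → trans (cong (λ y → unit y ⊗ unit (lookup d i)) (VecP.lookup-map i inv d)) (inv-unit _))

  fromRows-act : ∀ {n} (d e : Vec (Fin s) n) A i j →
    fromRows (act d e A) i j ≈ enum (unit (lookup d i)) ×ᶠ fromRows A i j ×ᶠ enum (unit (lookup e j))
  fromRows-act d e A i j = begin
    fromRows (act d e A) i j
      ≡⟨ cong enum (trans (cong (λ w → lookup w j) (VecP.lookup-zipWith (λ c → actRow c e) i d A))
           (VecP.lookup-zipWith (λ y x → unit (lookup d i) ⊗ x ⊗ unit y) j e (lookup A i))) ⟩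
    enum (unit (lookup d i) ⊗ lookup (lookup A i) j ⊗ unit (lookup e j))
      ≈⟨ F.trans (enum-⊗ _ _) (F.*-cong (enum-⊗ _ _) F.refl) ⟩
    enum (unit (lookup d i)) ×ᶠ fromRows A i j ×ᶠ enum (unit (lookup e j)) ∎
    where open SetoidReasoning F.setoid

  sameDoubleCoset⇒orbit : ∀ {n} (A B : Rows n n) → SameDoubleCoset n (fromRows A) (fromRows B) → _~_ n A B
  sameDoubleCoset⇒orbit A B (D , E , ΔD , ΔE , B≋DAE) = (units ΔD , units ΔE) ,
    lookup-extensional (λ i → fromRow-injective _ _ (λ j → begin
      fromRows (act (units ΔD) (units ΔE) A) i j  ≈⟨ fromRows-act (units ΔD) (units ΔE) A i j ⟩
      enum (unit (lookup (units ΔD) i)) ×ᶠ fromRows A i j ×ᶠ enum (unit (lookup (units ΔE) j))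
                                                  ≈⟨ F.*-cong (F.*-cong (enum-units ΔD i) F.refl) (enum-units ΔE j) ⟩
      D i i ×ᶠ fromRows A i j ×ᶠ E j j            ≈⟨ diagonal-sandwich (proj₁ ΔD) (proj₁ ΔE) (fromRows A) i j ⟨
      ((D · fromRows A) · E) i j                  ≈⟨ B≋DAE i j ⟨
      fromRows B i j                              ∎))
    where open SetoidReasoning F.setoid

  -- The target is an arbitrary matrix, known by its rows only up to `≋`, because the
  -- representatives must cover all of `GL`.
  orbit⇒sameDoubleCoset : ∀ {n} (A : Rows n n) (B : Mat n) → _~_ n A (toRows B) → SameDoubleCoset n (fromRows A) B
  orbit⇒sameDoubleCoset A B ((d , e) , dAe≡B) = diagonalMatrix d , diagonalMatrix e , diagonalMatrix-Δ d , diagonalMatrix-Δ e , λ i j → begin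
    B i j                               ≈⟨ fromRows-toRows B i j ⟨
    fromRows (toRows B) i j             ≡⟨ cong (λ X → fromRows X i j) dAe≡B ⟨
    fromRows (act d e A) i j            ≈⟨ fromRows-act d e A i j ⟩
    enum (unit (lookup d i)) ×ᶠ fromRows A i j ×ᶠ enum (unit (lookup e j))
      ≈⟨ F.*-cong (F.*-cong (diagonalMatrix-≡ d i) F.refl) (diagonalMatrix-≡ e j) ⟨
    diagonalMatrix d i i ×ᶠ fromRows A i j ×ᶠ diagonalMatrix e j j
      ≈⟨ diagonal-sandwich (diagonalMatrix-diagonal d) (diagonalMatrix-diagonal e) (fromRows A) i j ⟨
    ((diagonalMatrix d · fromRows A) · diagonalMatrix e) i j ∎
    where open SetoidReasoning F.setoid

  numDoubleCosets : ∀ n → NumDoubleCosets n (length (reps n))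
  numDoubleCosets n = List.map fromRows (reps n)
    , ListP.length-map fromRows (reps n)
    , AllP.map⁺ (All.map (λ {A} → independent⇒GL A) (reps-Q n))
    , AllPairsP.map⁺ (AllPairs.map (λ {A} {B} A≁B same → A≁B (sameDoubleCoset⇒orbit A B same)) (reps-distinct n))
    , λ A A∈GL → AnyP.map⁺ (Any.map (λ {R} → orbit⇒sameDoubleCoset R A)
        (reps-cover n (toRows A) (GL⇒independent (toRows A) (GL-resp (λ i j → F.sym (fromRows-toRows A i j)) A∈GL))))

-- Comparison of the count with the formula.

theorem3 : ∀ {c ℓ} (q : ℕ) → IsPrimePower q → (F : FiniteField c ℓ q) →
    (n : ℕ) → 1 ≤ n →
    Σ ℕ λ k → Matrices.NumDoubleCosets F n k × ι k ≡ rhs q n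
-- For `q = 0` the zero of the field would have an index in `Fin 0`.
theorem3 zero    _ F n _ with FiniteField.enum-surjective F (FiniteField.0# F)
... | () , _
theorem3 (suc s) _ F n _ = length (reps n) , numDoubleCosets n , (begin
  ι k                       ≡⟨ ℚP.*-identityˡ (ι k) ⟨
  1ℚ * ι k                  ≡⟨ cong (_* ι k) (÷'-inverse P P≢0) ⟨
  P * (1ℚ ÷' P) * ι k       ≡⟨ solve 3 (λ p i k → p :* i :* k := i :* (k :* p)) refl P (1ℚ ÷' P) (ι k) ⟩
  (1ℚ ÷' P) * (ι k * P)     ≡⟨ cong ((1ℚ ÷' P) *_) (orbit-count n) ⟩
  (1ℚ ÷' P) * Colourings.total (suc s) s n n ≡⟨ rhs-total s n ⟨
  rhs (suc s) n             ∎)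
  where
  open ≡-Reasoning
  open +-*-Solver
  open Enumerated F
  open DiagonalAction 𝔽
  k = length (reps n)
  P = ι (s ℕ.^ (2 ℕ.* n))
  -- The unit 1 of the field is an element of `Fin s`, so `q - 1` is nonzero and division by its
  -- powers is genuine.
  nonzero : ∀ {s} → Fin s → s ≢ 0
  nonzero Fin.zero    ()
  nonzero (Fin.suc _) ()
  P≢0 : P ≢ 0ℚ
  P≢0 = ι≢0 (s ℕ.^ (2 ℕ.* n)) (ℕ.≢-nonZero⁻¹ _ {{ℕP.m^n≢0 s (2 ℕ.* n) {{ℕ.≢-nonZero (nonzero one)}}}})
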